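{- Let $\lambda$ be a nonzero real number and $n$ a positive integer. Then $$\frac{\lambda^{n-1}}{n}(1)_{n,\frac{1}{\lambda}}=\sum_{k=1}^{n}\beta_{k-1,\lambda}(1-\lambda)\,S_{1,\lambda}(n,k).$$
   Context: For real $y$, $\mu\neq 0$ and integer $k\ge0$: $(y)_{0,\mu}=1$, $(y)_{k,\mu}=y(y-\mu)\cdots(y-(k-1)\mu)$ (used with $\mu=\lambda$ and $\mu=1/\lambda$); $(y)_0=1$, $(y)_k=y(y-1)\cdots(y-k+1)$. The degenerate exponential is $e_\lambda^x(t)=\sum_{k\ge0}(x)_{k,\lambda}t^k/k!=(1+\lambda t)^{x/\lambda}$, $e_\lambda(t)=e^1_\lambda(t)$. The degenerate Bernoulli polynomials are defined by $\frac{t}{e_\lambda(t)-1}e_\lambda^x(t)=\sum_{n\ge0}\beta_{n,\lambda}(x)\frac{t^n}{n!}$. The degenerate Stirling numbers of the first kind are defined by $(x)_{n}=\sum_{k=0}^{n}S_{1,\lambda}(n,k)(x)_{k,\lambda}$ ($n\ge0$). -}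

module Defs where

open import Algebra.Apartness.Bundles using (HeytingField; HeytingCommutativeRing)
open import Algebra.Bundles using (CommutativeRing)
import Algebra.Apartness.Properties.HeytingCommutativeRing as HeytingProperties
import Algebra.Properties.CommutativeSemigroup as CommutativeSemigroupProperties
import Algebra.Properties.Ring as RingProperties
import Algebra.Properties.Semiring.Exp as SemiringExp
import Algebra.Properties.Semiring.Mult as SemiringMult
import Algebra.Properties.Semiring.Sum as SemiringSum
open import Data.Fin.Base using (Fin; zero; suc; toℕ; fromℕ; inject₁)
import Data.Fin.Properties as Fin
open import Data.Nat.Base as ℕ using (ℕ; zero; suc; _∸_; _!)
import Data.Nat.Properties as ℕ
open import Data.Product.Base using (∃-syntax; _×_; _,_; proj₁; proj₂)
open import Data.Sum.Base using (_⊎_; inj₁; inj₂)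
open import Data.Vec.Functional as Vector using (Vector)
open import Level using (0ℓ; _⊔_)
import Relation.Binary.Reasoning.Setoid as SetoidReasoning
open import Relation.Binary.PropositionalEquality as ≡ using (_≡_; _≢_)
open import Relation.Nullary using (¬_; yes; no; contradiction)

module FieldArithmetic {c ℓ₁ ℓ₂} (F : HeytingField c ℓ₁ ℓ₂) where
  open HeytingField F public hiding (zero)
  open CommutativeRing (HeytingCommutativeRing.commutativeRing heytingCommutativeRing) public
    using (semiring; ring; +-commutativeSemigroup)
  open SemiringMult semiring public using () renaming (_×_ to _·_)
  open SemiringExp semiring public using (_^_)
  open SemiringSum semiring public using (sum-syntax; sum⁺-syntax)

  -- Every natural number n ≥ 1 is invertible.
  CharacteristicZero : Set ℓ₂
  CharacteristicZero = ∀ n → .{{_ : ℕ.NonZero n}} → n · 1# # 0#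

  -- #⇒invertible inverts x - 0#, which is x only up to _≈_.
  recip : ∀ x → x # 0# → Carrier
  recip x x#0 = proj₁ (#⇒invertible x#0)

  recip-inverse : ∀ x (x#0 : x # 0#) → x * recip x x#0 ≈ 1#
  recip-inverse x x#0 = trans (*-cong (sym (HeytingProperties.x-0≈x heytingCommutativeRing x)) refl)
    (proj₂ (proj₂ (#⇒invertible x#0)))

-- The real numbers: Cauchy sequences of rationals with explicit moduli,
-- identified when their difference tends to zero.
module CauchyReals where
  open import Data.Rational.Base using (ℚ; 0ℚ; 1ℚ; ½; _+_; _*_; -_; _-_; 1/_; ∣_∣; _<_; _≤_; positive; ≢-nonZero)
  import Data.Rational.Properties as ℚ
  import Data.Rational.Base as ℚ using (_⊔_)
  open import Data.Rational.Solver using (module +-*-Solver)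
  open ≡ using (refl; cong; cong₂; subst)

  IsCauchy : (ℕ → ℚ) → Set
  IsCauchy u = ∀ ε → 0ℚ < ε →
    ∃[ N ] (∀ m n → N ℕ.≤ m → N ℕ.≤ n → ∣ u m - u n ∣ < ε)

  record ℝ : Set where
    constructor mkℝ
    field
      seq      : ℕ → ℚ
      isCauchy : IsCauchy seq

  open ℝ public

  Eventually : (ℕ → Set) → Set
  Eventually P = ∃[ N ] (∀ n → N ℕ.≤ n → P n)

  infix 4 _≈ℝ_ _#ℝ_

  _≈ℝ_ : ℝ → ℝ → Set
  x ≈ℝ y = ∀ ε → 0ℚ < ε → Eventually (λ n → ∣ seq x n - seq y n ∣ < ε)

  -- Apartness, the constructive form of x ≠ y: the distance from x to y is
  -- bounded away from zero.
  _#ℝ_ : ℝ → ℝ → Set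
  x #ℝ y = ∃[ ε ] (0ℚ < ε × Eventually (λ n → ε ≤ ∣ seq x n - seq y n ∣))

  private
    half-pos : ∀ {ε} → 0ℚ < ε → 0ℚ < ε * ½
    half-pos {ε} 0<ε = ℚ.positive⁻¹ (ε * ½) {{ℚ.pos*pos⇒pos ε {{positive 0<ε}} ½}}

    half+half : ∀ ε → ε * ½ + ε * ½ ≡ ε
    half+half ε = ≡.trans (≡.sym (ℚ.*-distribˡ-+ ε ½ ½)) (ℚ.*-identityʳ ε)

    *-pos : ∀ {p q} → 0ℚ < p → 0ℚ < q → 0ℚ < p * q
    *-pos {p} {q} 0<p 0<q = ℚ.positive⁻¹ (p * q) {{ℚ.pos*pos⇒pos p {{positive 0<p}} q {{positive 0<q}}}}

    abs-sub-comm : ∀ p q → ∣ p - q ∣ ≡ ∣ q - p ∣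
    abs-sub-comm p q = ≡.trans (≡.sym (ℚ.∣-p∣≡∣p∣ (p - q))) (cong ∣_∣ (solve 2 (λ p q → :- (p :- q) := q :- p) refl p q))
      where open +-*-Solver

    triangle : ∀ p q r → ∣ p - r ∣ ≤ ∣ p - q ∣ + ∣ q - r ∣
    triangle p q r = subst (λ s → ∣ s ∣ ≤ ∣ p - q ∣ + ∣ q - r ∣)
      (solve 3 (λ p q r → (p :- q) :+ (q :- r) := p :- r) refl p q r)
      (ℚ.∣p+q∣≤∣p∣+∣q∣ (p - q) (q - r))
      where open +-*-Solver

    abs-split : ∀ p q → ∣ p ∣ ≤ ∣ p - q ∣ + ∣ q ∣
    abs-split p q = subst (λ s → ∣ s ∣ ≤ ∣ p - q ∣ + ∣ q ∣)
      (solve 2 (λ p q → (p :- q) :+ q := p) refl p q)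
      (ℚ.∣p+q∣≤∣p∣+∣q∣ (p - q) q)
      where open +-*-Solver

    abs-+ : ∀ a b c d → ∣ (a + b) - (c + d) ∣ ≤ ∣ a - c ∣ + ∣ b - d ∣
    abs-+ a b c d = subst (λ s → ∣ s ∣ ≤ ∣ a - c ∣ + ∣ b - d ∣)
      (solve 4 (λ a b c d → (a :- c) :+ (b :- d) := (a :+ b) :- (c :+ d)) refl a b c d)
      (ℚ.∣p+q∣≤∣p∣+∣q∣ (a - c) (b - d))
      where open +-*-Solver

    abs-neg : ∀ a c → ∣ (- a) - (- c) ∣ ≡ ∣ a - c ∣
    abs-neg a c = ≡.trans (cong ∣_∣ (solve 2 (λ a c → (:- a) :- (:- c) := c :- a) refl a c)) (abs-sub-comm c a)
      where open +-*-Solver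

    lt-halves : ∀ {ε p q r} → p ≤ q + r → q < ε * ½ → r < ε * ½ → p < ε
    lt-halves {ε} p≤q+r q< r< = ℚ.≤-<-trans p≤q+r (subst (_ <_) (half+half ε) (ℚ.+-mono-< q< r<))

    le-half : ∀ {ε q r} → ε ≤ q + r → q < ε * ½ → ε * ½ ≤ r
    le-half ε≤q+r q< = ℚ.≮⇒≥ (λ r< → ℚ.<-irrefl refl (lt-halves ε≤q+r q< r<))

    _∧ᵉ_ : ∀ {P Q} → Eventually P → Eventually Q → Eventually (λ n → P n × Q n)
    (M , p) ∧ᵉ (N , q) = M ℕ.⊔ N , λ n le →
      p n (ℕ.≤-trans (ℕ.m≤m⊔n M N) le) , q n (ℕ.≤-trans (ℕ.m≤n⊔m M N) le)

    mapᵉ : ∀ {P Q : ℕ → Set} → (∀ n → P n → Q n) → Eventually P → Eventually Q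
    mapᵉ f (N , p) = N , λ n le → f n (p n le)

    0<1 : 0ℚ < 1ℚ
    0<1 = ℚ.positive⁻¹ 1ℚ

    bounded : ∀ x → ∃[ K ] (0ℚ < K × Eventually (λ n → ∣ seq x n ∣ ≤ K))
    bounded x = let (N , c) = isCauchy x 1ℚ 0<1 in
      1ℚ + ∣ seq x N ∣ ,
      ℚ.<-≤-trans 0<1 (subst (_≤ 1ℚ + ∣ seq x N ∣) (ℚ.+-identityʳ 1ℚ) (ℚ.+-monoʳ-≤ 1ℚ (ℚ.0≤∣p∣ (seq x N)))) ,
      N , λ n le → ℚ.≤-trans (abs-split (seq x n) (seq x N))
                     (ℚ.+-monoˡ-≤ ∣ seq x N ∣ (ℚ.<⇒≤ (c n N le ℕ.≤-refl)))

    bounded₂ : ∀ x y → ∃[ K ] (0ℚ < K × Eventually (λ n → ∣ seq x n ∣ ≤ K × ∣ seq y n ∣ ≤ K))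
    bounded₂ x y = let (K , 0<K , p) = bounded x
                       (L , _ , q) = bounded y in
      K ℚ.⊔ L , ℚ.<-≤-trans 0<K (ℚ.p≤p⊔q K L) ,
      mapᵉ (λ n (a , b) → ℚ.≤-trans a (ℚ.p≤p⊔q K L) , ℚ.≤-trans b (ℚ.p≤q⊔p K L)) (p ∧ᵉ q)

    *-close : ∀ K → 0ℚ < K → ∀ ε → 0ℚ < ε → ∃[ δ ] (0ℚ < δ ×
      (∀ a b c d → ∣ a ∣ ≤ K → ∣ d ∣ ≤ K → ∣ a - c ∣ < δ → ∣ b - d ∣ < δ → ∣ a * b - c * d ∣ < ε))
    *-close K 0<K ε 0<ε = δ , *-pos (half-pos 0<ε) (ℚ.positive⁻¹ (1/ K) {{ℚ.1/pos⇒pos K}}) , close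
      where
      open +-*-Solver
      instance
        _ = positive 0<K
        _ = ℚ.pos⇒nonZero K {{positive 0<K}}
        _ = ℚ.pos⇒nonNeg K
      δ = (ε * ½) * (1/ K)
      δK : δ * K ≡ ε * ½
      δK = ≡.trans (ℚ.*-assoc (ε * ½) (1/ K) K) (≡.trans (cong ((ε * ½) *_) (ℚ.*-inverseˡ K)) (ℚ.*-identityʳ (ε * ½)))
      close : ∀ a b c d → ∣ a ∣ ≤ K → ∣ d ∣ ≤ K → ∣ a - c ∣ < δ → ∣ b - d ∣ < δ → ∣ a * b - c * d ∣ < ε
      close a b c d a≤ d≤ ac bd = lt-halves bound
        (part (b - d) a a≤ bd)
        (part (a - c) d d≤ ac)
        where
        bound : ∣ a * b - c * d ∣ ≤ ∣ (b - d) * a ∣ + ∣ (a - c) * d ∣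
        bound = subst (λ s → ∣ s ∣ ≤ ∣ (b - d) * a ∣ + ∣ (a - c) * d ∣)
          (solve 4 (λ a b c d → (b :- d) :* a :+ (a :- c) :* d := a :* b :- c :* d) refl a b c d)
          (ℚ.∣p+q∣≤∣p∣+∣q∣ ((b - d) * a) ((a - c) * d))
        part : ∀ p q → ∣ q ∣ ≤ K → ∣ p ∣ < δ → ∣ p * q ∣ < ε * ½
        part p q q≤ p< = ℚ.≤-<-trans
          (subst (_≤ ∣ p ∣ * K) (≡.sym (ℚ.∣p*q∣≡∣p∣*∣q∣ p q)) (ℚ.*-monoˡ-≤-nonNeg ∣ p ∣ {{ℚ.∣-∣-nonNeg p}} q≤))
          (subst (∣ p ∣ * K <_) δK (ℚ.*-monoˡ-<-pos K p<))

  infix  8 -ℝ_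
  infixl 7 _*ℝ_
  infixl 6 _+ℝ_

  fromℚ : ℚ → ℝ
  seq (fromℚ q) _ = q
  isCauchy (fromℚ q) ε 0<ε = 0 , λ _ _ _ _ → subst (λ s → ∣ s ∣ < ε) (≡.sym (ℚ.+-inverseʳ q)) 0<ε

  0ℝ 1ℝ : ℝ
  0ℝ = fromℚ 0ℚ
  1ℝ = fromℚ 1ℚ

  _+ℝ_ : ℝ → ℝ → ℝ
  seq (x +ℝ y) n = seq x n + seq y n
  isCauchy (x +ℝ y) ε 0<ε =
    let (M , p) = isCauchy x (ε * ½) (half-pos 0<ε)
        (N , q) = isCauchy y (ε * ½) (half-pos 0<ε)
        left  = λ {k} → ℕ.≤-trans {k = k} (ℕ.m≤m⊔n M N)
        right = λ {k} → ℕ.≤-trans {k = k} (ℕ.m≤n⊔m M N) in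
    M ℕ.⊔ N , λ m n m≥ n≥ → lt-halves (abs-+ (seq x m) (seq y m) (seq x n) (seq y n))
      (p m n (left m≥) (left n≥)) (q m n (right m≥) (right n≥))

  -ℝ_ : ℝ → ℝ
  seq (-ℝ x) n = - seq x n
  isCauchy (-ℝ x) ε 0<ε = let (N , p) = isCauchy x ε 0<ε in
    N , λ m n m≥ n≥ → subst (_< ε) (≡.sym (abs-neg (seq x m) (seq x n))) (p m n m≥ n≥)

  _*ℝ_ : ℝ → ℝ → ℝ
  seq (x *ℝ y) n = seq x n * seq y n
  isCauchy (x *ℝ y) ε 0<ε =
    let (K , 0<K , L , b) = bounded₂ x y
        (δ , 0<δ , close) = *-close K 0<K ε 0<ε
        (M , p) = isCauchy x δ 0<δ
        (N , q) = isCauchy y δ 0<δ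
        inL = λ {k} → ℕ.≤-trans {k = k} (ℕ.m≤m⊔n L (M ℕ.⊔ N))
        inM = λ {k} r → ℕ.≤-trans {k = k} (ℕ.m≤m⊔n M N) (ℕ.≤-trans (ℕ.m≤n⊔m L (M ℕ.⊔ N)) r)
        inN = λ {k} r → ℕ.≤-trans {k = k} (ℕ.m≤n⊔m M N) (ℕ.≤-trans (ℕ.m≤n⊔m L (M ℕ.⊔ N)) r) in
    L ℕ.⊔ (M ℕ.⊔ N) , λ m n m≥ n≥ → close (seq x m) (seq y m) (seq x n) (seq y n)
      (proj₁ (b m (inL m≥))) (proj₂ (b n (inL n≥)))
      (p m n (inM m≥) (inM n≥)) (q m n (inN m≥) (inN n≥))

  private
    pointwise : ∀ {x y} → (∀ n → seq x n ≡ seq y n) → x ≈ℝ y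
    pointwise {x} {y} eq ε 0<ε = 0 , λ n _ →
      subst (λ s → ∣ s ∣ < ε) (≡.sym (≡.trans (cong (_- seq y n) (eq n)) (ℚ.+-inverseʳ (seq y n)))) 0<ε

    ≈ℝ-sym : ∀ {x y} → x ≈ℝ y → y ≈ℝ x
    ≈ℝ-sym {x} {y} x≈y ε 0<ε = mapᵉ (λ n → subst (_< ε) (abs-sub-comm (seq x n) (seq y n))) (x≈y ε 0<ε)

    ≈ℝ-trans : ∀ {x y z} → x ≈ℝ y → y ≈ℝ z → x ≈ℝ z
    ≈ℝ-trans {x} {y} {z} x≈y y≈z ε 0<ε =
      mapᵉ (λ n (p , q) → lt-halves (triangle (seq x n) (seq y n) (seq z n)) p q)
        (x≈y _ (half-pos 0<ε) ∧ᵉ y≈z _ (half-pos 0<ε))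

    +ℝ-cong : ∀ {x y u v} → x ≈ℝ y → u ≈ℝ v → x +ℝ u ≈ℝ y +ℝ v
    +ℝ-cong {x} {y} {u} {v} x≈y u≈v ε 0<ε =
      mapᵉ (λ n (p , q) → lt-halves (abs-+ (seq x n) (seq u n) (seq y n) (seq v n)) p q)
        (x≈y _ (half-pos 0<ε) ∧ᵉ u≈v _ (half-pos 0<ε))

    -ℝ-cong : ∀ {x y} → x ≈ℝ y → -ℝ x ≈ℝ -ℝ y
    -ℝ-cong {x} {y} x≈y ε 0<ε =
      mapᵉ (λ n → subst (_< ε) (≡.sym (abs-neg (seq x n) (seq y n)))) (x≈y ε 0<ε)

    *ℝ-cong : ∀ {x y u v} → x ≈ℝ y → u ≈ℝ v → x *ℝ u ≈ℝ y *ℝ v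
    *ℝ-cong {x} {y} {u} {v} x≈y u≈v ε 0<ε =
      let (K , 0<K , b) = bounded₂ x v
          (δ , 0<δ , close) = *-close K 0<K ε 0<ε in
      mapᵉ (λ n ((bx , bv) , p , q) → close (seq x n) (seq u n) (seq y n) (seq v n) bx bv p q)
        (b ∧ᵉ (x≈y δ 0<δ ∧ᵉ u≈v δ 0<δ))

  ℝ-commutativeRing : CommutativeRing 0ℓ 0ℓ
  ℝ-commutativeRing = record
    { Carrier = ℝ ; _≈_ = _≈ℝ_ ; _+_ = _+ℝ_ ; _*_ = _*ℝ_ ; -_ = -ℝ_ ; 0# = 0ℝ ; 1# = 1ℝ
    ; isCommutativeRing = record
      { isRing = record
        { +-isAbelianGroup = record
          { isGroup = record
            { isMonoid = record
              { isSemigroup = record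
                { isMagma = record
                  { isEquivalence = record
                    { refl  = λ {x} → pointwise {x} {x} (λ _ → refl)
                    ; sym   = λ {x y} → ≈ℝ-sym {x} {y}
                    ; trans = λ {x y z} → ≈ℝ-trans {x} {y} {z}
                    }
                  ; ∙-cong = λ {x y u v} → +ℝ-cong {x} {y} {u} {v}
                  }
                ; assoc = λ x y z → pointwise {(x +ℝ y) +ℝ z} {x +ℝ (y +ℝ z)} (λ n → ℚ.+-assoc (seq x n) (seq y n) (seq z n))
                }
              ; identity = (λ x → pointwise {0ℝ +ℝ x} {x} (λ n → ℚ.+-identityˡ (seq x n)))
                         , (λ x → pointwise {x +ℝ 0ℝ} {x} (λ n → ℚ.+-identityʳ (seq x n)))
              }
            ; inverse = (λ x → pointwise {(-ℝ x) +ℝ x} {0ℝ} (λ n → ℚ.+-inverseˡ (seq x n)))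
                      , (λ x → pointwise {x +ℝ (-ℝ x)} {0ℝ} (λ n → ℚ.+-inverseʳ (seq x n)))
            ; ⁻¹-cong = λ {x y} → -ℝ-cong {x} {y}
            }
          ; comm = λ x y → pointwise {x +ℝ y} {y +ℝ x} (λ n → ℚ.+-comm (seq x n) (seq y n))
          }
        ; *-cong = λ {x y u v} → *ℝ-cong {x} {y} {u} {v}
        ; *-assoc = λ x y z → pointwise {(x *ℝ y) *ℝ z} {x *ℝ (y *ℝ z)} (λ n → ℚ.*-assoc (seq x n) (seq y n) (seq z n))
        ; *-identity = (λ x → pointwise {1ℝ *ℝ x} {x} (λ n → ℚ.*-identityˡ (seq x n)))
                     , (λ x → pointwise {x *ℝ 1ℝ} {x} (λ n → ℚ.*-identityʳ (seq x n)))
        ; distrib = (λ x y z → pointwise {x *ℝ (y +ℝ z)} {x *ℝ y +ℝ x *ℝ z} (λ n → ℚ.*-distribˡ-+ (seq x n) (seq y n) (seq z n)))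
                  , (λ x y z → pointwise {(y +ℝ z) *ℝ x} {y *ℝ x +ℝ z *ℝ x} (λ n → ℚ.*-distribʳ-+ (seq x n) (seq y n) (seq z n)))
        }
      ; *-comm = λ x y → pointwise {x *ℝ y} {y *ℝ x} (λ n → ℚ.*-comm (seq x n) (seq y n))
      }
    }

  private
    persist : ∀ z ε → 0ℚ < ε →
      ∃[ N ] (∀ m → N ℕ.≤ m → ε ≤ ∣ seq z m ∣ → Eventually (λ n → ε * ½ ≤ ∣ seq z n ∣))
    persist z ε 0<ε = let (N , c) = isCauchy z (ε * ½) (half-pos 0<ε) in
      N , λ m m≥ ε≤ → N , λ n n≥ →
        le-half (ℚ.≤-trans ε≤ (abs-split (seq z m) (seq z n))) (c m n m≥ n≥)

    #ℝ-irrefl : ∀ {x y} → x ≈ℝ y → ¬ x #ℝ y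
    #ℝ-irrefl x≈y (ε , 0<ε , e) = let (N , p) = x≈y ε 0<ε ∧ᵉ e
                                      (lt , le) = p N ℕ.≤-refl in
      ℚ.<-irrefl refl (ℚ.<-≤-trans lt le)

    #ℝ-sym : ∀ {x y} → x #ℝ y → y #ℝ x
    #ℝ-sym {x} {y} (ε , 0<ε , e) =
      ε , 0<ε , mapᵉ (λ n → subst (ε ≤_) (abs-sub-comm (seq x n) (seq y n))) e

    #ℝ-cotrans : ∀ {x y} → x #ℝ y → ∀ z → (x #ℝ z) ⊎ (z #ℝ y)
    #ℝ-cotrans {x} {y} (ε , 0<ε , N , e) z = decide (ε * ½ ℚ.≤? ∣ seq x k - seq z k ∣)
      where
      0<h = half-pos 0<ε
      P = persist (x +ℝ (-ℝ z)) (ε * ½) 0<h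
      Q = persist (z +ℝ (-ℝ y)) (ε * ½) 0<h
      k = N ℕ.⊔ (proj₁ P ℕ.⊔ proj₁ Q)
      inP = ℕ.≤-trans (ℕ.m≤m⊔n (proj₁ P) (proj₁ Q)) (ℕ.m≤n⊔m N (proj₁ P ℕ.⊔ proj₁ Q))
      inQ = ℕ.≤-trans (ℕ.m≤n⊔m (proj₁ P) (proj₁ Q)) (ℕ.m≤n⊔m N (proj₁ P ℕ.⊔ proj₁ Q))
      decide : _ → (x #ℝ z) ⊎ (z #ℝ y)
      decide (yes le) = inj₁ (_ , half-pos 0<h , proj₂ P k inP le)
      decide (no ¬le) = inj₂ (_ , half-pos 0<h , proj₂ Q k inQ
        (le-half (ℚ.≤-trans (e k (ℕ.m≤m⊔n N _)) (triangle (seq x k) (seq z k) (seq y k))) (ℚ.≰⇒> ¬le)))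

    #ℝ-tight : ∀ x y → ¬ x #ℝ y → x ≈ℝ y
    #ℝ-tight x y ¬x#y ε 0<ε = k , λ n n≥ → lt-halves (abs-split (seq z n) (seq z k))
        (proj₂ C n k (ℕ.≤-trans (ℕ.m≤n⊔m (proj₁ P) (proj₁ C)) n≥) (ℕ.m≤n⊔m (proj₁ P) (proj₁ C)))
        (ℚ.≰⇒> (λ le → ¬x#y (_ , half-pos 0<h , proj₂ P k (ℕ.m≤m⊔n (proj₁ P) (proj₁ C)) le)))
      where
      z = x +ℝ (-ℝ y)
      0<h = half-pos 0<ε
      P = persist z (ε * ½) 0<h
      C = isCauchy z (ε * ½) 0<h
      k = proj₁ P ℕ.⊔ proj₁ C

    invℚ : ℚ → ℚ
    invℚ q with q ℚ.≟ 0ℚ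
    ... | yes _  = 0ℚ
    ... | no q≢0 = (1/ q) {{≢-nonZero q≢0}}

    *-invℚ : ∀ {q} → q ≢ 0ℚ → q * invℚ q ≡ 1ℚ
    *-invℚ {q} q≢0 with q ℚ.≟ 0ℚ
    ... | yes q≡0 = contradiction q≡0 q≢0
    ... | no q≢0′ = ℚ.*-inverseʳ q {{≢-nonZero q≢0′}}

    away⇒≢0 : ∀ {ε q} → 0ℚ < ε → ε ≤ ∣ q ∣ → q ≢ 0ℚ
    away⇒≢0 0<ε ε≤∣q∣ refl = ℚ.<-irrefl refl (ℚ.<-≤-trans 0<ε ε≤∣q∣)

    invℚ-close : ∀ {ε η a b} → 0ℚ < ε → ε ≤ ∣ a ∣ → ε ≤ ∣ b ∣ →
      ∣ a - b ∣ < (η * ε) * ε → ∣ invℚ a - invℚ b ∣ < η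
    invℚ-close {ε} {η} {a} {b} 0<ε ε≤a ε≤b lt =
      ℚ.*-cancelʳ-<-nonNeg ε (ℚ.*-cancelʳ-<-nonNeg ε (ℚ.≤-<-trans le lt))
      where
      open +-*-Solver
      instance
        _ = ℚ.pos⇒nonNeg ε {{positive 0<ε}}
        _ = ℚ.∣-∣-nonNeg b
      d = invℚ a - invℚ b
      instance
        _ = ℚ.∣-∣-nonNeg d
        _ = ℚ.nonNeg*nonNeg⇒nonNeg ∣ d ∣ ε
      d*a*b : (d * a) * b ≡ b - a
      d*a*b = ≡.trans
        (solve 4 (λ a b i j → ((i :- j) :* a) :* b := (a :* i) :* b :- (b :* j) :* a) refl a b (invℚ a) (invℚ b))
        (cong₂ _-_ (≡.trans (cong (_* b) (*-invℚ (away⇒≢0 0<ε ε≤a))) (ℚ.*-identityˡ b))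
                   (≡.trans (cong (_* a) (*-invℚ (away⇒≢0 0<ε ε≤b))) (ℚ.*-identityˡ a)))
      ∣d∣*∣a∣*∣b∣ : (∣ d ∣ * ∣ a ∣) * ∣ b ∣ ≡ ∣ a - b ∣
      ∣d∣*∣a∣*∣b∣ = ≡.trans (cong (_* ∣ b ∣) (≡.sym (ℚ.∣p*q∣≡∣p∣*∣q∣ d a)))
        (≡.trans (≡.sym (ℚ.∣p*q∣≡∣p∣*∣q∣ (d * a) b)) (≡.trans (cong ∣_∣ d*a*b) (abs-sub-comm b a)))
      le : (∣ d ∣ * ε) * ε ≤ ∣ a - b ∣
      le = subst ((∣ d ∣ * ε) * ε ≤_) ∣d∣*∣a∣*∣b∣
        (ℚ.≤-trans (ℚ.*-monoˡ-≤-nonNeg (∣ d ∣ * ε) ε≤b)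
                   (ℚ.*-monoʳ-≤-nonNeg ∣ b ∣ (ℚ.*-monoˡ-≤-nonNeg ∣ d ∣ ε≤a)))

    module _ {x y : ℝ} where
      private
        z = x +ℝ (-ℝ y)

      #ℝ⇒invertible : x #ℝ y → ∃[ w ] (w *ℝ z ≈ℝ 1ℝ × z *ℝ w ≈ℝ 1ℝ)
      #ℝ⇒invertible (ε , 0<ε , N , e) = w ,
          ≈ℝ-trans {w *ℝ z} {z *ℝ w} {1ℝ} (pointwise {w *ℝ z} {z *ℝ w} (λ n → ℚ.*-comm (seq w n) (seq z n))) zw , zw
        where
        w : ℝ
        seq w n = invℚ (seq z n)
        isCauchy w η 0<η =
          let (M , c) = isCauchy z ((η * ε) * ε) (*-pos (*-pos 0<η 0<ε) 0<ε)
              inN = λ {k} → ℕ.≤-trans {k = k} (ℕ.m≤m⊔n N M)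
              inM = λ {k} → ℕ.≤-trans {k = k} (ℕ.m≤n⊔m N M) in
          N ℕ.⊔ M , λ m n m≥ n≥ →
            invℚ-close 0<ε (e m (inN m≥)) (e n (inN n≥)) (c m n (inM m≥) (inM n≥))
        zw : z *ℝ w ≈ℝ 1ℝ
        zw η 0<η = N , λ n n≥ → subst (λ s → ∣ s - 1ℚ ∣ < η) (≡.sym (*-invℚ (away⇒≢0 0<ε (e n n≥)))) 0<η

      invertible⇒#ℝ : ∃[ w ] (w *ℝ z ≈ℝ 1ℝ × z *ℝ w ≈ℝ 1ℝ) → x #ℝ y
      invertible⇒#ℝ (w , _ , zw) =
        let (K , 0<K , b) = bounded w
            instance
              _ = positive 0<K
              _ = ℚ.pos⇒nonZero K {{positive 0<K}}
            0<1/K = ℚ.positive⁻¹ (1/ K) {{ℚ.1/pos⇒pos K}}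
            h/K*K : (½ * 1/ K) * K ≡ ½
            h/K*K = ≡.trans (ℚ.*-assoc ½ (1/ K) K) (cong (½ *_) (ℚ.*-inverseˡ K)) in
        ½ * 1/ K , *-pos (ℚ.positive⁻¹ ½) 0<1/K ,
        mapᵉ (λ n (∣w∣≤K , close) → ℚ.*-cancelʳ-≤-pos K (ℚ.≤-trans
                (subst (_≤ ∣ seq z n * seq w n ∣) (≡.sym h/K*K)
                  (le-half {1ℚ} (ℚ.≤-trans (abs-split 1ℚ (seq z n * seq w n)) ℚ.≤-refl)
                    (subst (_< ½) (abs-sub-comm (seq z n * seq w n) 1ℚ) close)))
                (subst (_≤ ∣ seq z n ∣ * K) (≡.sym (ℚ.∣p*q∣≡∣p∣*∣q∣ (seq z n) (seq w n)))
                  (ℚ.*-monoˡ-≤-nonNeg ∣ seq z n ∣ {{ℚ.∣-∣-nonNeg (seq z n)}} ∣w∣≤K))))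
          (b ∧ᵉ zw ½ (ℚ.positive⁻¹ ½))

  ℝ-heytingField : HeytingField 0ℓ 0ℓ 0ℓ
  ℝ-heytingField = record
    { Carrier = ℝ ; _≈_ = _≈ℝ_ ; _#_ = _#ℝ_ ; _+_ = _+ℝ_ ; _*_ = _*ℝ_ ; -_ = -ℝ_ ; 0# = 0ℝ ; 1# = 1ℝ
    ; isHeytingField = record
      { isHeytingCommutativeRing = record
        { isCommutativeRing   = CommutativeRing.isCommutativeRing ℝ-commutativeRing
        ; isApartnessRelation = record
          { irrefl  = λ {x y} → #ℝ-irrefl {x} {y}
          ; sym     = λ {x y} → #ℝ-sym {x} {y}
          ; cotrans = λ {x y} → #ℝ-cotrans {x} {y}
          }
        ; #⇒invertible = λ {x y} → #ℝ⇒invertible {x} {y}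
        ; invertible⇒# = λ {x y} → invertible⇒#ℝ {x} {y}
        }
      ; tight = λ x y → #ℝ-tight x y , #ℝ-irrefl {x} {y}
      }
    }

  ℝ-characteristicZero : FieldArithmetic.CharacteristicZero ℝ-heytingField
  ℝ-characteristicZero (suc n) = 1ℚ , 0<1 , 0 , λ k _ →
    subst (1ℚ ≤_)
      (≡.sym (≡.trans (cong ∣_∣ (ℚ.+-identityʳ (seq (suc n · 1ℝ) k))) (ℚ.0≤p⇒∣p∣≡p (nonNeg (suc n) k))))
      (subst (_≤ 1ℚ + seq (n · 1ℝ) k) (ℚ.+-identityʳ 1ℚ) (ℚ.+-monoʳ-≤ 1ℚ (nonNeg n k)))
    where
    open FieldArithmetic ℝ-heytingField using (_·_)
    nonNeg : ∀ n k → 0ℚ ≤ seq (n · 1ℝ) k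
    nonNeg zero    k = ℚ.≤-refl
    nonNeg (suc n) k = ℚ.+-mono-≤ (ℚ.<⇒≤ 0<1) (nonNeg n k)

open CauchyReals public

module Degenerate {c ℓ₁ ℓ₂} (F : HeytingField c ℓ₁ ℓ₂)
                  (charZero : FieldArithmetic.CharacteristicZero F) where
  open FieldArithmetic F
  open HeytingProperties heytingCommutativeRing using (1#0; #-congʳ)
  open SemiringSum semiring hiding (sum-syntax; sum⁺-syntax)
  open SetoidReasoning setoid

  infixl 7 _/ℕ_ _⊛_
  infixl 6 _⊖_

  _/ℕ_ : Carrier → ∀ n → .{{_ : ℕ.NonZero n}} → Carrier
  x /ℕ n = x * recip (n · 1#) (charZero n)

  -- (y)_{k,μ} = y (y - μ) ⋯ (y - (k-1) μ)
  fallingBy : Carrier → Carrier → ℕ → Carrier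
  fallingBy μ y zero    = 1#
  fallingBy μ y (suc k) = fallingBy μ y k * (y - k · μ)

  -- (y)_k = y (y - 1) ⋯ (y - k + 1)
  falling : Carrier → ℕ → Carrier
  falling y zero    = 1#
  falling y (suc k) = falling y k * (y - k · 1#)

  -- Formal power series in t, given by the coefficients of t^n.
  Series : Set c
  Series = ℕ → Carrier

  1ₛ tₛ : Series
  1ₛ zero    = 1#
  1ₛ (suc _) = 0#
  tₛ zero    = 0#
  tₛ (suc n) = 1ₛ n

  _⊖_ _⊛_ : Series → Series → Series
  (f ⊖ g) n = f n - g n
  (f ⊛ g) n = ∑[ i ≤ n ] (f (toℕ i) * g (n ∸ toℕ i))

  -- The reciprocal h of g: h₀ = 1/g₀ and
  -- h_{n+1} = - (1/g₀) (g₁ h_n + g₂ h_{n-1} + ⋯ + g_{n+1} h₀).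
  module _ (g : Series) (g₀#0 : g 0 # 0#) where
    -- h_n , h_{n-1} , … , h₀
    inverseCoefficients : ∀ n → Vector Carrier (suc n)
    inverseCoefficients zero    _ = recip (g 0) g₀#0
    inverseCoefficients (suc n) =
      (- (recip (g 0) g₀#0 * ∑[ i ≤ n ] (g (suc (toℕ i)) * inverseCoefficients n i)))
      Vector.∷ inverseCoefficients n

    inverse : Series
    inverse n = inverseCoefficients n zero

    private
      lookup-inverse : ∀ n i → inverseCoefficients n i ≡ inverse (n ∸ toℕ i)
      lookup-inverse n       zero     = ≡.refl
      lookup-inverse (suc n) (suc i)  = lookup-inverse n i

    ⊛-inverse : ∀ n → (g ⊛ inverse) n ≈ 1ₛ n
    ⊛-inverse zero = trans (+-identityʳ _) (recip-inverse (g 0) g₀#0)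
    ⊛-inverse (suc n) = begin
      g 0 * - (r * s) + s′   ≈⟨ +-cong (sym (RingProperties.-‿distribʳ-* ring _ _)) (sum-cong-≋ (λ i → *-congˡ {g (suc (toℕ i))} (reflexive (≡.sym (lookup-inverse n i))))) ⟩
      - (g 0 * (r * s)) + s  ≈⟨ +-congʳ (-‿cong (trans (sym (*-assoc _ _ _)) (trans (*-congʳ (recip-inverse (g 0) g₀#0)) (*-identityˡ s)))) ⟩
      - s + s                ≈⟨ -‿inverseˡ s ⟩
      0#                     ∎
      where
      r = recip (g 0) g₀#0
      s = ∑[ i ≤ n ] (g (suc (toℕ i)) * inverseCoefficients n i)
      s′ = ∑[ i ≤ n ] (g (suc (toℕ i)) * inverse (n ∸ toℕ i))

  -- e_λ^x(t) = Σ_k (x)_{k,λ} t^k / k!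
  expSeries : Carrier → Carrier → Series
  expSeries λ₀ x k = (fallingBy λ₀ x k /ℕ k !) {{ℕ._!≢0 k}}

  -- (e_λ(t) - 1) / t; the constant coefficient of e_λ(t) - 1 is zero.
  [e-1]/t : Carrier → Series
  [e-1]/t λ₀ n = (expSeries λ₀ 1# ⊖ 1ₛ) (suc n)

  private
    recip-one : recip (1 · 1#) (charZero 1) ≈ 1#
    recip-one = trans (sym (trans (*-congʳ (+-identityʳ 1#)) (*-identityˡ _))) (recip-inverse (1 · 1#) (charZero 1))

    x-0≈x : ∀ x → x - 0# ≈ x
    x-0≈x = HeytingProperties.x-0≈x heytingCommutativeRing

    [e-1]/t₀≈1 : ∀ λ₀ → [e-1]/t λ₀ 0 ≈ 1#
    [e-1]/t₀≈1 λ₀ = begin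
      (1# * (1# - 0#)) * recip (1 · 1#) (charZero 1) - 0#  ≈⟨ x-0≈x _ ⟩
      (1# * (1# - 0#)) * recip (1 · 1#) (charZero 1)       ≈⟨ *-cong (trans (*-identityˡ _) (x-0≈x 1#)) recip-one ⟩
      1# * 1#                                              ≈⟨ *-identityˡ 1# ⟩
      1#                                                   ∎

  [e-1]/t₀#0 : ∀ λ₀ → [e-1]/t λ₀ 0 # 0#
  [e-1]/t₀#0 λ₀ = #-congʳ (sym ([e-1]/t₀≈1 λ₀)) 1#0

  -- t / (e_λ(t) - 1)
  t/[e-1] : Carrier → Series
  t/[e-1] λ₀ = inverse ([e-1]/t λ₀) ([e-1]/t₀#0 λ₀)

  [e-1]⊛t/[e-1] : ∀ λ₀ n → ((expSeries λ₀ 1# ⊖ 1ₛ) ⊛ t/[e-1] λ₀) n ≈ tₛ n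
  [e-1]⊛t/[e-1] λ₀ n = trans (head-vanishes n) (shift n)
    where
    f = expSeries λ₀ 1# ⊖ 1ₛ
    h = t/[e-1] λ₀
    f₀≈0 : f 0 ≈ 0#
    f₀≈0 = trans (+-congʳ (trans (*-identityˡ _) recip-one)) (-‿inverseʳ 1#)
    rest : ∀ n → Carrier
    rest n = ∑[ i < n ] (f (suc (toℕ i)) * h (n ∸ suc (toℕ i)))
    head-vanishes : ∀ n → (f ⊛ h) n ≈ rest n
    head-vanishes n = trans (+-congʳ (trans (*-congʳ f₀≈0) (zeroˡ _))) (+-identityˡ _)
    shift : ∀ n → rest n ≈ tₛ n
    shift zero    = refl
    shift (suc n) = ⊛-inverse ([e-1]/t λ₀) ([e-1]/t₀#0 λ₀) n

  -- β_{n,λ}(x) is n! times the coefficient of t^n in t/(e_λ(t) - 1) · e_λ^x(t).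
  β : Carrier → ℕ → Carrier → Carrier
  β λ₀ n x = ((n !) · 1#) * (t/[e-1] λ₀ ⊛ expSeries λ₀ x) n

  -- The values S n k with k > n do not enter the defining expansions.
  IsDegenerateStirling₁ : Carrier → (ℕ → ℕ → Carrier) → Set (c ⊔ ℓ₁)
  IsDegenerateStirling₁ λ₀ S =
    ∀ n x → falling x n ≈ ∑[ k ≤ n ] (S n (toℕ k) * fallingBy λ₀ x (toℕ k))

  -- A family satisfying the defining expansions, via
  -- (x)_{k,λ} (x - n) = (x)_{k+1,λ} + (kλ - n) (x)_{k,λ}.
  degenerateStirling₁ : Carrier → ℕ → ℕ → Carrier
  degenerateStirling₁ λ₀ zero    zero    = 1#
  degenerateStirling₁ λ₀ zero    (suc k) = 0#
  degenerateStirling₁ λ₀ (suc n) zero    = (0# - n · 1#) * degenerateStirling₁ λ₀ n 0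
  degenerateStirling₁ λ₀ (suc n) (suc k) =
    degenerateStirling₁ λ₀ n k + (suc k · λ₀ - n · 1#) * degenerateStirling₁ λ₀ n (suc k)

  private
    stirling-vanishes : ∀ λ₀ n k → n ℕ.< k → degenerateStirling₁ λ₀ n k ≈ 0#
    stirling-vanishes λ₀ zero    (suc k) _           = refl
    stirling-vanishes λ₀ (suc n) (suc k) (ℕ.s≤s n<k) =
      trans (+-cong (stirling-vanishes λ₀ n k n<k)
                    (trans (*-congˡ (stirling-vanishes λ₀ n (suc k) (ℕ.m<n⇒m<1+n n<k))) (zeroʳ _)))
            (+-identityʳ 0#)

  degenerateStirling₁-isDegenerateStirling₁ : ∀ λ₀ → IsDegenerateStirling₁ λ₀ (degenerateStirling₁ λ₀)
  degenerateStirling₁-isDegenerateStirling₁ λ₀ zero    x = sym (trans (+-identityʳ _) (*-identityˡ 1#))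
  degenerateStirling₁-isDegenerateStirling₁ λ₀ (suc n) x = begin
    falling x n * (x - n · 1#)
      ≈⟨ *-congʳ (degenerateStirling₁-isDegenerateStirling₁ λ₀ n x) ⟩
    (∑[ k ≤ n ] (A (toℕ k) * f (toℕ k))) * (x - n · 1#)
      ≈⟨ *-distribʳ-sum (x - n · 1#) (λ (k : Fin (suc n)) → A (toℕ k) * f (toℕ k)) ⟩
    ∑[ k ≤ n ] (A (toℕ k) * f (toℕ k) * (x - n · 1#))
      ≈⟨ sum-cong-≋ (λ (k : Fin (suc n)) → expand (toℕ k)) ⟩
    ∑[ k ≤ n ] (A (toℕ k) * f (suc (toℕ k)) + term (toℕ k))
      ≈⟨ ∑-distrib-+ (λ (k : Fin (suc n)) → A (toℕ k) * f (suc (toℕ k))) (λ k → term (toℕ k)) ⟩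
    ∑[ k ≤ n ] (A (toℕ k) * f (suc (toℕ k))) + ∑[ k ≤ n ] term (toℕ k)
      ≈⟨ +-congˡ extend ⟨
    ∑[ k ≤ n ] (A (toℕ k) * f (suc (toℕ k))) + (term 0 + ∑[ k ≤ n ] term (suc (toℕ k)))
      ≈⟨ CommutativeSemigroupProperties.x∙yz≈y∙xz +-commutativeSemigroup _ _ _ ⟩
    term 0 + (∑[ k ≤ n ] (A (toℕ k) * f (suc (toℕ k))) + ∑[ k ≤ n ] term (suc (toℕ k)))
      ≈⟨ +-congˡ (∑-distrib-+ (λ (k : Fin (suc n)) → A (toℕ k) * f (suc (toℕ k))) (λ k → term (suc (toℕ k)))) ⟨
    term 0 + ∑[ k ≤ n ] (A (toℕ k) * f (suc (toℕ k)) + term (suc (toℕ k)))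
      ≈⟨ +-congˡ (sum-cong-≋ (λ (k : Fin (suc n)) → distribʳ (f (suc (toℕ k))) (A (toℕ k)) ((suc (toℕ k) · λ₀ - n · 1#) * A (suc (toℕ k))))) ⟨
    ∑[ k ≤ suc n ] (degenerateStirling₁ λ₀ (suc n) (toℕ k) * f (toℕ k)) ∎
    where
    A = degenerateStirling₁ λ₀ n
    f = fallingBy λ₀ x
    term : ℕ → Carrier
    term k = (k · λ₀ - n · 1#) * A k * f k
    expand : ∀ k → A k * f k * (x - n · 1#) ≈ A k * f (suc k) + term k
    expand k = begin
      A k * f k * (x - n · 1#)
        ≈⟨ *-congˡ (sym split) ⟩
      A k * f k * ((x - k · λ₀) + (k · λ₀ - n · 1#))
        ≈⟨ distribˡ _ _ _ ⟩
      A k * f k * (x - k · λ₀) + A k * f k * (k · λ₀ - n · 1#)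
        ≈⟨ +-cong (*-assoc _ _ _) (trans (*-comm _ _) (sym (*-assoc _ _ _))) ⟩
      A k * f (suc k) + term k ∎
      where
      split : (x - k · λ₀) + (k · λ₀ - n · 1#) ≈ x - n · 1#
      split = trans (+-assoc _ _ _) (+-congˡ (trans (sym (+-assoc _ _ _)) (trans (+-congʳ (-‿inverseˡ _)) (+-identityˡ _))))
    extend : ∑[ k ≤ suc n ] term (toℕ k) ≈ ∑[ k ≤ n ] term (toℕ k)
    extend = begin
      ∑[ k ≤ suc n ] term (toℕ k)
        ≈⟨ sum-init-last (λ (k : Fin (suc (suc n))) → term (toℕ k)) ⟩
      ∑[ k ≤ n ] term (toℕ (inject₁ k)) + term (toℕ (fromℕ (suc n)))
        ≈⟨ +-cong (sum-cong-≋ (λ (k : Fin (suc n)) → reflexive (≡.cong term (Fin.toℕ-inject₁ k)))) last≈0 ⟩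
      ∑[ k ≤ n ] term (toℕ k) + 0#
        ≈⟨ +-identityʳ _ ⟩
      ∑[ k ≤ n ] term (toℕ k) ∎
      where
      last≈0 : term (toℕ (fromℕ (suc n))) ≈ 0#
      last≈0 = trans (reflexive (≡.cong term (Fin.toℕ-fromℕ (suc n))))
        (trans (*-congʳ (trans (*-congˡ (stirling-vanishes λ₀ n (suc n) ℕ.≤-refl)) (zeroʳ _))) (zeroˡ _))

open FieldArithmetic ℝ-heytingField public using (_≈_; _#_; _*_; _-_; 0#; 1#; _^_; recip; sum-syntax)
open Degenerate ℝ-heytingField ℝ-characteristicZero public

{-# OPTIONS --safe #-}
module Submission where

-- Write e^x for e_λ^x(t) and let ψ be the linear functional on power series
-- with ψ(e^x) = (x + λ - 1)_n. Since (e^1 - 1) e^x = e^{x+1} - e^x, the functional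
-- f ↦ ψ((e^1 - 1) f) sends e^x to n (x + λ - 1)_{n-1}. Dividing the expansion of
-- (x + λ)_n by x + λ shows that f ↦ n Σ_j j! S₁(n, j+1) [t^j] f does the same at
-- x = iλ, and functionals that agree on all e^{iλ} = (1 + λt)^i are equal.
-- At f = t/(e^1 - 1) · e^{1-λ} the second functional gives n times the right-hand
-- side, and the first gives ψ(t e^{1-λ}) = ψ(e^1 - e^{1-λ})/λ = (λ)_n/λ.

open import Defs using (module FieldArithmetic; module Degenerate)
open import Algebra.Apartness.Bundles using (HeytingField; HeytingCommutativeRing)
open import Algebra.Bundles using (CommutativeRing)
import Algebra.Apartness.Properties.HeytingCommutativeRing as HeytingProperties
import Algebra.Properties.Ring as RingProperties
import Algebra.Properties.Semiring.Mult as SemiringMult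
import Algebra.Properties.Semiring.Sum as SemiringSum
import Algebra.Solver.Ring.NaturalCoefficients.Default as SemiringSolver
open import Data.Fin.Base using (Fin; toℕ)
open import Data.Fin.Properties using (toℕ<n)
open import Data.Nat.Base as ℕ using (ℕ; zero; suc; NonZero; _∸_; _!; _≤_; _<_; z≤n; s≤s)
import Data.Nat.Properties as ℕ
open import Data.Sum.Base using (inj₁; inj₂)
open import Level using (_⊔_)
import Relation.Binary.PropositionalEquality as ≡
open import Relation.Nullary using (contradiction)
import Relation.Binary.Reasoning.Setoid as SetoidReasoning

-- A record type is compared by its parameters, one operation at a time: this
-- keeps the instantiation at ℝ from unfolding whole terms into Cauchy sequences.
record Identity {a ℓ₁ ℓ₂ ℓ₃} (A : Set a) (_≈_ : A → A → Set ℓ₁) (_#_ : A → A → Set ℓ₂)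
                (_*_ _-_ : A → A → A) (0# 1# : A) (_^_ : A → ℕ → A)
                (recip : ∀ x → x # 0# → A) (_/ℕ_ : A → ∀ n → .{{_ : NonZero n}} → A)
                (sum : ∀ n → (Fin n → A) → A)
                (fallingBy : A → A → ℕ → A) (β : A → ℕ → A → A)
                (IsStirling₁ : A → (ℕ → ℕ → A) → Set ℓ₃) : Set (a ⊔ ℓ₁ ⊔ ℓ₂ ⊔ ℓ₃) where
  field
    holds : (λ₀ : A) (λ₀#0 : λ₀ # 0#) (n : ℕ) → .{{_ : NonZero n}} →
      (S : ℕ → ℕ → A) → IsStirling₁ λ₀ S →
      (((λ₀ ^ (n ∸ 1)) /ℕ n) * fallingBy (recip λ₀ λ₀#0) 1# n)
        ≈ sum n (λ i → β λ₀ (toℕ i) (1# - λ₀) * S n (suc (toℕ i)))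

module DegenerateProperties {c ℓ₁ ℓ₂} (F : HeytingField c ℓ₁ ℓ₂)
                            (charZero : FieldArithmetic.CharacteristicZero F) where
  open FieldArithmetic F
  open Degenerate F charZero
  private
    commutativeRing = HeytingCommutativeRing.commutativeRing heytingCommutativeRing
  open CommutativeRing commutativeRing using (commutativeSemiring)
  open HeytingProperties heytingCommutativeRing using (1#0; x-0≈x; x#0y#0→xy#0; #-congʳ)
  open RingProperties ring using (x+x≈x⇒x≈0; -1*x≈-x; x[y-z]≈xy-xz; //-rightDividesˡ; //-rightDividesʳ)
  open SemiringMult semiring using (×-congʳ; ×-comm-*; ×-assoc-*; ×1-homo-*)
  open SemiringSum semiring using (sum-cong-≋; ∑-distrib-+; *-distribˡ-sum)
  open SemiringSolver commutativeSemiring using (solve; _:=_; _:+_; _:*_; con)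
  open SetoidReasoning setoid

  -- Cancellation, powers and natural multiples

  *-cancelˡ-# : ∀ {x y z} → x # 0# → x * y ≈ x * z → y ≈ z
  *-cancelˡ-# {x} {y} {z} x#0 xy≈xz = begin
    y                     ≈⟨ unit y ⟨
    recip x x#0 * (x * y) ≈⟨ *-congˡ xy≈xz ⟩
    recip x x#0 * (x * z) ≈⟨ unit z ⟩
    z                     ∎
    where
    unit : ∀ w → recip x x#0 * (x * w) ≈ w
    unit w = trans (solve 3 (λ r x w → r :* (x :* w) := (x :* r) :* w) refl (recip x x#0) x w)
      (trans (*-congʳ (recip-inverse x x#0)) (*-identityˡ w))

  ^-#0 : ∀ {x} → x # 0# → ∀ n → x ^ n # 0#
  ^-#0 x#0 zero    = 1#0
  ^-#0 x#0 (suc n) = x#0y#0→xy#0 x#0 (^-#0 x#0 n)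

  ·-as-* : ∀ n x → n · x ≈ (n · 1#) * x
  ·-as-* n x = sym (trans (×-assoc-* n 1# x) (×-congʳ n (*-identityˡ x)))

  -- Falling factorials

  fallingBy-cong : ∀ {μ ν x y} → μ ≈ ν → x ≈ y → ∀ k → fallingBy μ x k ≈ fallingBy ν y k
  fallingBy-cong μ≈ν x≈y zero    = refl
  fallingBy-cong μ≈ν x≈y (suc k) =
    *-cong (fallingBy-cong μ≈ν x≈y k) (+-cong x≈y (-‿cong (×-congʳ k μ≈ν)))

  fallingBy-0 : ∀ μ k → fallingBy μ 0# (suc k) ≈ 0#
  fallingBy-0 μ zero    = trans (*-identityˡ _) (-‿inverseʳ 0#)
  fallingBy-0 μ (suc k) = trans (*-congʳ (fallingBy-0 μ k)) (zeroˡ _)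

  -- The left product is the right one shifted by one factor: `x + μ` comes first and then the
  -- factors of `fallingBy μ x k`. The recursion exposes the last factor, so induction carries
  -- `x + μ` along at the front.
  fallingBy-+μ : ∀ μ x k → fallingBy μ (x + μ) (suc k) ≈ (x + μ) * fallingBy μ x k
  fallingBy-+μ μ x zero    = trans (*-identityˡ _) (trans (x-0≈x (x + μ)) (sym (*-identityʳ _)))
  fallingBy-+μ μ x (suc k) = begin
    fallingBy μ (x + μ) (suc k) * (x + μ - (μ + k · μ))
      ≈⟨ *-cong (fallingBy-+μ μ x k) step ⟩
    (x + μ) * fallingBy μ x k * (x - k · μ)
      ≈⟨ *-assoc _ _ _ ⟩
    (x + μ) * fallingBy μ x (suc k) ∎
    where
    step : x + μ - (μ + k · μ) ≈ x - k · μ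
    step = begin
      x + μ - (μ + k · μ)
        ≈⟨ +-congʳ (+-congʳ (//-rightDividesˡ (k · μ) x)) ⟨
      x - k · μ + k · μ + μ - (μ + k · μ)
        ≈⟨ +-congʳ (solve 3 (λ d m u → d :+ m :+ u := d :+ (u :+ m)) refl (x - k · μ) (k · μ) μ) ⟩
      x - k · μ + (μ + k · μ) - (μ + k · μ)
        ≈⟨ //-rightDividesʳ _ _ ⟩
      x - k · μ ∎

  -- Split the leading factor `x + μ` as `(x - k · μ) + suc k · μ`; the first summand is exactly the
  -- next factor of the product.
  fallingBy-pascal : ∀ μ x k →
    fallingBy μ (x + μ) (suc k) ≈ (suc k · μ) * fallingBy μ x k + fallingBy μ x (suc k)
  fallingBy-pascal μ x k = begin
    fallingBy μ (x + μ) (suc k)               ≈⟨ fallingBy-+μ μ x k ⟩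
    (x + μ) * f                               ≈⟨ *-congʳ (+-congʳ (//-rightDividesˡ (k · μ) x)) ⟨
    (x - k · μ + k · μ + μ) * f
      ≈⟨ solve 4 (λ d m u f → (d :+ m :+ u) :* f := (u :+ m) :* f :+ f :* d) refl (x - k · μ) (k · μ) μ f ⟩
    (μ + k · μ) * f + f * (x - k · μ)         ∎
    where f = fallingBy μ x k

  falling≈fallingBy-1 : ∀ x k → falling x k ≈ fallingBy 1# x k
  falling≈fallingBy-1 x zero    = refl
  falling≈fallingBy-1 x (suc k) = *-congʳ (falling≈fallingBy-1 x k)

  falling-cong : ∀ {x y} → x ≈ y → ∀ k → falling x k ≈ falling y k
  falling-cong x≈y zero    = refl
  falling-cong x≈y (suc k) = *-cong (falling-cong x≈y k) (+-congʳ x≈y)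

  falling-0 : ∀ k → falling 0# (suc k) ≈ 0#
  falling-0 k = trans (falling≈fallingBy-1 0# (suc k)) (fallingBy-0 1# k)

  falling-+1 : ∀ x k → falling (x + 1#) (suc k) ≈ (x + 1#) * falling x k
  falling-+1 x k = trans (falling≈fallingBy-1 (x + 1#) (suc k))
    (trans (fallingBy-+μ 1# x k) (*-congˡ (sym (falling≈fallingBy-1 x k))))

  falling-pascal : ∀ x k →
    falling (x + 1#) (suc k) ≈ (suc k · 1#) * falling x k + falling x (suc k)
  falling-pascal x k = trans (falling≈fallingBy-1 (x + 1#) (suc k))
    (trans (fallingBy-pascal 1# x k)
      (sym (+-cong (*-congˡ (falling≈fallingBy-1 x k)) (falling≈fallingBy-1 x (suc k)))))

  -- Each factor `1 - j/x` absorbs one `x` and becomes `x - j`. This turns the left-hand side of the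
  -- identity into an ordinary falling factorial of λ.
  ^*fallingBy-recip : ∀ x (x#0 : x # 0#) k → x ^ k * fallingBy (recip x x#0) 1# k ≈ falling x k
  ^*fallingBy-recip x x#0 zero    = *-identityˡ 1#
  ^*fallingBy-recip x x#0 (suc k) = begin
    x * x ^ k * (f * (1# - k · r))
      ≈⟨ solve 4 (λ x p f d → x :* p :* (f :* d) := p :* f :* (x :* d)) refl x (x ^ k) f (1# - k · r) ⟩
    x ^ k * f * (x * (1# - k · r))
      ≈⟨ *-cong (^*fallingBy-recip x x#0 k) scale ⟩
    falling x k * (x - k · 1#) ∎
    where
    r = recip x x#0
    f = fallingBy r 1# k
    scale : x * (1# - k · r) ≈ x - k · 1#
    scale = begin
      x * (1# - k · r)         ≈⟨ x[y-z]≈xy-xz x 1# (k · r) ⟩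
      x * 1# - x * (k · r)     ≈⟨ +-cong (*-identityʳ x) (-‿cong (×-comm-* k x r)) ⟩
      x - k · (x * r)          ≈⟨ +-congˡ (-‿cong (×-congʳ k (recip-inverse x x#0))) ⟩
      x - k · 1#               ∎

  -- Power series

  shift : Series → Series
  shift f zero    = 0#
  shift f (suc n) = f n

  shift-cong : ∀ {f g} → (∀ n → f n ≈ g n) → ∀ n → shift f n ≈ shift g n
  shift-cong f≈g zero    = refl
  shift-cong f≈g (suc n) = f≈g n

  infix 7 _*ₛ_+ₛ_
  -- Scaling and addition form one operation, so that linearity is a single equation.
  _*ₛ_+ₛ_ : Carrier → Series → Series → Series
  (a *ₛ f +ₛ g) n = a * f n + g n

  -- Agreement up to `n` is enough, which later preserves the bound on how many coefficients a
  -- functional reads. As in the lemmas below, the induction replaces the left factor by its tail,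
  -- as the sum unfolds.
  ⊛-congʳ : ∀ h n {f g} → (∀ k → k ≤ n → f k ≈ g k) → (h ⊛ f) n ≈ (h ⊛ g) n
  ⊛-congʳ h zero    f≈g = +-congʳ (*-congˡ (f≈g 0 z≤n))
  ⊛-congʳ h (suc n) f≈g = +-cong (*-congˡ (f≈g (suc n) ℕ.≤-refl))
    (⊛-congʳ (λ k → h (suc k)) n (λ k k≤n → f≈g k (ℕ.m≤n⇒m≤1+n k≤n)))

  ⊛-congˡ : ∀ n {f g} h → (∀ k → f k ≈ g k) → (f ⊛ h) n ≈ (g ⊛ h) n
  ⊛-congˡ zero    h f≈g = +-congʳ (*-congʳ (f≈g 0))
  ⊛-congˡ (suc n) h f≈g = +-cong (*-congʳ (f≈g 0)) (⊛-congˡ n h (λ k → f≈g (suc k)))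

  ⊛-linearʳ : ∀ h a f g n → (h ⊛ (a *ₛ f +ₛ g)) n ≈ (a *ₛ (h ⊛ f) +ₛ (h ⊛ g)) n
  ⊛-linearʳ h a f g zero =
    solve 4 (λ h a f g → h :* (a :* f :+ g) :+ con 0 := a :* (h :* f :+ con 0) :+ (h :* g :+ con 0))
      refl (h 0) a (f 0) (g 0)
  ⊛-linearʳ h a f g (suc n) = trans (+-congˡ (⊛-linearʳ (λ k → h (suc k)) a f g n))
    (solve 6 (λ h a f g p q → h :* (a :* f :+ g) :+ (a :* p :+ q) := a :* (h :* f :+ p) :+ (h :* g :+ q))
      refl (h 0) a (f (suc n)) (g (suc n)) _ _)

  ⊛-linearˡ : ∀ h a f g n → ((a *ₛ f +ₛ g) ⊛ h) n ≈ (a *ₛ (f ⊛ h) +ₛ (g ⊛ h)) n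
  ⊛-linearˡ h a f g zero =
    solve 4 (λ h a f g → (a :* f :+ g) :* h :+ con 0 := a :* (f :* h :+ con 0) :+ (g :* h :+ con 0))
      refl (h 0) a (f 0) (g 0)
  ⊛-linearˡ h a f g (suc n) = trans (+-congˡ (⊛-linearˡ h a (λ k → f (suc k)) (λ k → g (suc k)) n))
    (solve 6 (λ h a f g p q → (a :* f :+ g) :* h :+ (a :* p :+ q) := a :* (f :* h :+ p) :+ (g :* h :+ q))
      refl (h (suc n)) a (f 0) (g 0) _ _)

  -- The tail of `f ⊛ g` is definitionally `f 0 *ₛ g′ +ₛ (f′ ⊛ g)`, so linearity in the left factor
  -- reduces the claim to the tail `f′`.
  ⊛-assoc : ∀ f g h n → ((f ⊛ g) ⊛ h) n ≈ (f ⊛ (g ⊛ h)) n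
  ⊛-assoc f g h zero =
    solve 3 (λ f g h → (f :* g :+ con 0) :* h :+ con 0 := f :* (g :* h :+ con 0) :+ con 0)
      refl (f 0) (g 0) (h 0)
  ⊛-assoc f g h (suc n) = begin
    (f 0 * g 0 + 0#) * h (suc n) + ((f 0 *ₛ g′ +ₛ (f′ ⊛ g)) ⊛ h) n
      ≈⟨ +-congˡ (⊛-linearˡ h (f 0) g′ (f′ ⊛ g) n) ⟩
    (f 0 * g 0 + 0#) * h (suc n) + (f 0 * (g′ ⊛ h) n + ((f′ ⊛ g) ⊛ h) n)
      ≈⟨ +-congˡ (+-congˡ (⊛-assoc f′ g h n)) ⟩
    (f 0 * g 0 + 0#) * h (suc n) + (f 0 * (g′ ⊛ h) n + (f′ ⊛ (g ⊛ h)) n)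
      ≈⟨ solve 5 (λ f g h p q → (f :* g :+ con 0) :* h :+ (f :* p :+ q) := f :* (g :* h :+ p) :+ q)
           refl (f 0) (g 0) (h (suc n)) _ _ ⟩
    f 0 * (g 0 * h (suc n) + (g′ ⊛ h) n) + (f′ ⊛ (g ⊛ h)) n ∎
    where
    f′ g′ : Series
    f′ k = f (suc k)
    g′ k = g (suc k)

  ⊛-zeroˡ : ∀ f n → ((λ _ → 0#) ⊛ f) n ≈ 0#
  ⊛-zeroˡ f zero    = trans (+-identityʳ _) (zeroˡ _)
  ⊛-zeroˡ f (suc n) = trans (+-cong (zeroˡ _) (⊛-zeroˡ f n)) (+-identityʳ 0#)

  ⊛-identityˡ : ∀ f n → (1ₛ ⊛ f) n ≈ f n
  ⊛-identityˡ f zero    = trans (+-identityʳ _) (*-identityˡ _)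
  ⊛-identityˡ f (suc n) = trans (+-cong (*-identityˡ _) (⊛-zeroˡ f n)) (+-identityʳ _)

  ⊛-identityʳ : ∀ f n → (f ⊛ 1ₛ) n ≈ f n
  ⊛-identityʳ f zero    = trans (+-identityʳ _) (*-identityʳ _)
  ⊛-identityʳ f (suc n) = trans (+-cong (zeroʳ _) (⊛-identityʳ (λ k → f (suc k)) n)) (+-identityˡ _)

  tₛ-⊛ : ∀ f n → (tₛ ⊛ f) n ≈ shift f n
  tₛ-⊛ f zero    = trans (+-identityʳ _) (zeroˡ _)
  tₛ-⊛ f (suc n) = trans (+-cong (zeroˡ _) (⊛-identityˡ f n)) (+-identityˡ _)

  ⊛-shift : ∀ f g n → (f ⊛ shift g) n ≈ shift (f ⊛ g) n
  ⊛-shift f g zero          = trans (+-identityʳ _) (zeroʳ _)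
  ⊛-shift f g (suc zero)    = +-congˡ (⊛-shift (λ k → f (suc k)) g zero)
  ⊛-shift f g (suc (suc n)) = +-congˡ (⊛-shift (λ k → f (suc k)) g (suc n))

  -- Degenerate exponentials

  module _ (λ₀ : Carrier) where
    private
      e : Carrier → Series
      e = expSeries λ₀

      1/_! : ℕ → Carrier
      1/ k ! = recip ((k !) · 1#) (charZero (k !) {{ℕ._!≢0 k}})

    k!*exp : ∀ x k → ((k !) · 1#) * e x k ≈ fallingBy λ₀ x k
    k!*exp x k = begin
      ((k !) · 1#) * (fallingBy λ₀ x k * 1/ k !)
        ≈⟨ solve 3 (λ a b c → a :* (b :* c) := (a :* c) :* b) refl _ _ _ ⟩
      ((k !) · 1#) * 1/ k ! * fallingBy λ₀ x k
        ≈⟨ *-congʳ (recip-inverse _ _) ⟩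
      1# * fallingBy λ₀ x k
        ≈⟨ *-identityˡ _ ⟩
      fallingBy λ₀ x k ∎

    [1+k]/[1+k]! : ∀ k → (suc k · 1#) * 1/ suc k ! ≈ 1/ k !
    [1+k]/[1+k]! k = *-cancelˡ-# (charZero (k !) {{ℕ._!≢0 k}}) (begin
      ((k !) · 1#) * ((suc k · 1#) * 1/ suc k !)
        ≈⟨ solve 3 (λ a b c → a :* (b :* c) := (b :* a) :* c) refl _ _ _ ⟩
      (suc k · 1#) * ((k !) · 1#) * 1/ suc k !
        ≈⟨ *-congʳ (×1-homo-* (suc k) (k !)) ⟨
      ((suc k !) · 1#) * 1/ suc k !
        ≈⟨ recip-inverse _ _ ⟩
      1#
        ≈⟨ recip-inverse _ _ ⟨
      ((k !) · 1#) * 1/ k ! ∎)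

    exp-cong : ∀ {x y} → x ≈ y → ∀ k → e x k ≈ e y k
    exp-cong x≈y k = *-congʳ (fallingBy-cong refl x≈y k)

    exp₀≈1 : ∀ x → e x 0 ≈ 1#
    exp₀≈1 x = trans (sym (trans (*-congʳ (+-identityʳ 1#)) (*-identityˡ _))) (k!*exp x 0)

    exp-0 : ∀ k → e 0# k ≈ 1ₛ k
    exp-0 zero    = exp₀≈1 0#
    exp-0 (suc k) = trans (*-congʳ (fallingBy-0 λ₀ k)) (zeroˡ _)

    -- The differential equation (1 + λt) d/dt e^x = x e^x, read off coefficientwise.
    exp-suc : ∀ x k → (suc k · 1#) * e x (suc k) ≈ (x - k · λ₀) * e x k
    exp-suc x k = begin
      (suc k · 1#) * (fallingBy λ₀ x k * (x - k · λ₀) * 1/ suc k !)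
        ≈⟨ solve 4 (λ n f d r → n :* (f :* d :* r) := d :* (f :* (n :* r))) refl _ _ _ _ ⟩
      (x - k · λ₀) * (fallingBy λ₀ x k * ((suc k · 1#) * 1/ suc k !))
        ≈⟨ *-congˡ (*-congˡ ([1+k]/[1+k]! k)) ⟩
      (x - k · λ₀) * (fallingBy λ₀ x k * 1/ k !) ∎

    -- e_λ^{x+λ}(t) = (1 + λ t) e_λ^x(t)
    exp-+λ : ∀ x k → e (x + λ₀) k ≈ (λ₀ *ₛ shift (e x) +ₛ e x) k
    exp-+λ x zero    = trans (exp₀≈1 (x + λ₀))
      (sym (trans (+-congʳ (zeroʳ λ₀)) (trans (+-identityˡ _) (exp₀≈1 x))))
    exp-+λ x (suc k) = begin
      fallingBy λ₀ (x + λ₀) (suc k) * r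
        ≈⟨ *-congʳ (fallingBy-pascal λ₀ x k) ⟩
      ((suc k · λ₀) * f + g) * r
        ≈⟨ *-congʳ (+-congʳ (*-congʳ (·-as-* (suc k) λ₀))) ⟩
      ((suc k · 1#) * λ₀ * f + g) * r
        ≈⟨ solve 5 (λ n l f g r → (n :* l :* f :+ g) :* r := l :* (f :* (n :* r)) :+ g :* r) refl _ _ _ _ _ ⟩
      λ₀ * (f * ((suc k · 1#) * r)) + g * r
        ≈⟨ +-congʳ (*-congˡ (*-congˡ ([1+k]/[1+k]! k))) ⟩
      λ₀ * (f * 1/ k !) + g * r ∎
      where
      r = 1/ suc k !
      f = fallingBy λ₀ x k
      g = fallingBy λ₀ x (suc k)

    exp-[1+i]λ : ∀ i k → e (suc i · λ₀) k ≈ (λ₀ *ₛ shift (e (i · λ₀)) +ₛ e (i · λ₀)) k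
    exp-[1+i]λ i k = trans (exp-cong (+-comm λ₀ (i · λ₀)) k) (exp-+λ (i · λ₀) k)

    -- The series is the polynomial (1 + λt)^i, of degree at most i.
    exp-iλ-above : ∀ i k → i < k → e (i · λ₀) k ≈ 0#
    exp-iλ-above zero    (suc k) i<k       = exp-0 (suc k)
    exp-iλ-above (suc i) (suc k) (s≤s i<k) = begin
      e (suc i · λ₀) (suc k)                     ≈⟨ exp-[1+i]λ i (suc k) ⟩
      λ₀ * e (i · λ₀) k + e (i · λ₀) (suc k)
        ≈⟨ +-cong (*-congˡ (exp-iλ-above i k i<k)) (exp-iλ-above i (suc k) (ℕ.m<n⇒m<1+n i<k)) ⟩
      λ₀ * 0# + 0#                               ≈⟨ trans (+-identityʳ _) (zeroʳ λ₀) ⟩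
      0#                                         ∎

    -- The top coefficient of (1 + λt)^i; it is invertible when λ is, so it can serve as a pivot.
    exp-iλ-diagonal : ∀ i → e (i · λ₀) i ≈ λ₀ ^ i
    exp-iλ-diagonal zero    = exp₀≈1 0#
    exp-iλ-diagonal (suc i) = begin
      e (suc i · λ₀) (suc i)                     ≈⟨ exp-[1+i]λ i (suc i) ⟩
      λ₀ * e (i · λ₀) i + e (i · λ₀) (suc i)
        ≈⟨ +-cong (*-congˡ (exp-iλ-diagonal i)) (exp-iλ-above i (suc i) ℕ.≤-refl) ⟩
      λ₀ * λ₀ ^ i + 0#                           ≈⟨ +-identityʳ _ ⟩
      λ₀ * λ₀ ^ i                                ∎

    -- With the second exponent a multiple of λ, the addition law follows by multiplying by 1 + λt
    -- repeatedly, without a Vandermonde convolution. These exponents suffice for testing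
    -- functionals.
    exp-⊛ : ∀ y i n → (e y ⊛ e (i · λ₀)) n ≈ e (y + i · λ₀) n
    exp-⊛ y zero n = begin
      (e y ⊛ e 0#) n  ≈⟨ ⊛-congʳ (e y) n (λ k _ → exp-0 k) ⟩
      (e y ⊛ 1ₛ) n    ≈⟨ ⊛-identityʳ (e y) n ⟩
      e y n           ≈⟨ exp-cong (+-identityʳ y) n ⟨
      e (y + 0#) n    ∎
    exp-⊛ y (suc i) n = begin
      (e y ⊛ e (suc i · λ₀)) n
        ≈⟨ ⊛-congʳ (e y) n (λ k _ → exp-[1+i]λ i k) ⟩
      (e y ⊛ (λ₀ *ₛ shift (e x) +ₛ e x)) n
        ≈⟨ ⊛-linearʳ (e y) λ₀ (shift (e x)) (e x) n ⟩
      λ₀ * (e y ⊛ shift (e x)) n + (e y ⊛ e x) n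
        ≈⟨ +-cong (*-congˡ (trans (⊛-shift (e y) (e x) n) (shift-cong (exp-⊛ y i) n))) (exp-⊛ y i n) ⟩
      λ₀ * shift (e (y + x)) n + e (y + x) n
        ≈⟨ exp-+λ (y + x) n ⟨
      e (y + x + λ₀) n
        ≈⟨ exp-cong (solve 3 (λ y x l → y :+ x :+ l := y :+ (l :+ x)) refl y x λ₀) n ⟩
      e (y + suc i · λ₀) n ∎
      where x = i · λ₀

  -- Linear functionals on power series

  -- `cong` says both that the functional respects equality and that it reads only the coefficients
  -- below `N`; this makes finitely many test series enough.
  record IsFinitaryLinear (N : ℕ) (Φ : Series → Carrier) : Set (c ⊔ ℓ₁) where
    field
      cong   : ∀ {f g} → (∀ k → k < N → f k ≈ g k) → Φ f ≈ Φ g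
      linear : ∀ a f g → Φ (a *ₛ f +ₛ g) ≈ a * Φ f + Φ g

    -- Below `N` the series `f + f` agrees with `f`, so `Φ f` is idempotent under addition.
    vanishes : ∀ f → (∀ k → k < N → f k ≈ 0#) → Φ f ≈ 0#
    vanishes f f≈0 = x+x≈x⇒x≈0 (Φ f) (begin
      Φ f + Φ f          ≈⟨ +-congʳ (*-identityˡ (Φ f)) ⟨
      1# * Φ f + Φ f     ≈⟨ linear 1# f f ⟨
      Φ (1# *ₛ f +ₛ f)   ≈⟨ cong (λ k k<N → trans (+-congˡ (f≈0 k k<N)) (trans (+-identityʳ _) (*-identityˡ _))) ⟩
      Φ f                ∎)

    scale : ∀ a f → Φ (λ k → a * f k) ≈ a * Φ f
    scale a f = begin
      Φ (λ k → a * f k)          ≈⟨ cong (λ k _ → +-identityʳ (a * f k)) ⟨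
      Φ (a *ₛ f +ₛ (λ _ → 0#))   ≈⟨ linear a f (λ _ → 0#) ⟩
      a * Φ f + Φ (λ _ → 0#)     ≈⟨ +-congˡ (vanishes (λ _ → 0#) (λ _ _ → refl)) ⟩
      a * Φ f + 0#               ≈⟨ +-identityʳ _ ⟩
      a * Φ f                    ∎

  open IsFinitaryLinear

  -- Coefficient `n` of `h ⊛ f` involves `f` only up to `n`, so the bound `N` is unchanged.
  ⊛-isFinitaryLinear : ∀ {N Φ} h → IsFinitaryLinear N Φ → IsFinitaryLinear N (λ f → Φ (h ⊛ f))
  ⊛-isFinitaryLinear h Φ-lin .cong f≈g =
    cong Φ-lin (λ n n<N → ⊛-congʳ h n (λ k k≤n → f≈g k (ℕ.≤-<-trans k≤n n<N)))
  ⊛-isFinitaryLinear {Φ = Φ} h Φ-lin .linear a f g =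
    trans (cong Φ-lin (λ n _ → ⊛-linearʳ h a f g n)) (linear Φ-lin a (h ⊛ f) (h ⊛ g))

  weightedSum : ℕ → Series → Series → Carrier
  weightedSum N w f = ∑[ i < N ] (w (toℕ i) * f (toℕ i))

  weightedSum-isFinitaryLinear : ∀ N w → IsFinitaryLinear N (weightedSum N w)
  weightedSum-isFinitaryLinear N w .cong f≈g =
    sum-cong-≋ (λ (i : Fin N) → *-congˡ (f≈g (toℕ i) (toℕ<n i)))
  weightedSum-isFinitaryLinear N w .linear a f g = begin
    ∑[ i < N ] (w (toℕ i) * (a * f (toℕ i) + g (toℕ i)))
      ≈⟨ sum-cong-≋ (λ (i : Fin N) → solve 4 (λ w a f g → w :* (a :* f :+ g) := a :* (w :* f) :+ w :* g) refl
           (w (toℕ i)) a (f (toℕ i)) (g (toℕ i))) ⟩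
    ∑[ i < N ] (a * (w (toℕ i) * f (toℕ i)) + w (toℕ i) * g (toℕ i))
      ≈⟨ ∑-distrib-+ (λ (i : Fin N) → a * (w (toℕ i) * f (toℕ i))) (λ i → w (toℕ i) * g (toℕ i)) ⟩
    ∑[ i < N ] (a * (w (toℕ i) * f (toℕ i))) + weightedSum N w g
      ≈⟨ +-congʳ (*-distribˡ-sum a (λ (i : Fin N) → w (toℕ i) * f (toℕ i))) ⟨
    a * weightedSum N w f + weightedSum N w g ∎

  module _ (λ₀ : Carrier) (λ₀#0 : λ₀ # 0#) where
    private
      e : Carrier → Series
      e = expSeries λ₀

    -- The series e_λ^{iλ}(t) = (1 + λ t)^i, i < N, form a basis modulo t^N:
    -- the top coefficient of f is cleared with the multiple of (1 + λ t)^m.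
    functionals-agree : ∀ {M N Φ Ψ} → IsFinitaryLinear M Φ → IsFinitaryLinear N Ψ → M ≤ N →
      (∀ i → Φ (e (i · λ₀)) ≈ Ψ (e (i · λ₀))) → ∀ f → Φ f ≈ Ψ f
    functionals-agree {M} {N} {Φ} {Ψ} Φ-lin Ψ-lin M≤N agree f =
      go N f (λ k N≤k k<N → contradiction k<N (ℕ.≤⇒≯ N≤k))
      where
      -- Induction on `m`, a bound on the degree of `f` modulo t^N. At zero both functionals see
      -- only zeros, `Φ` because `M ≤ N`; at `m = N` the hypothesis is vacuous.
      go : ∀ m f → (∀ k → m ≤ k → k < N → f k ≈ 0#) → Φ f ≈ Ψ f
      go zero    f f≈0 = trans (vanishes Φ-lin f (λ k k<M → f≈0 k z≤n (ℕ.<-≤-trans k<M M≤N)))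
        (sym (vanishes Ψ-lin f (λ k → f≈0 k z≤n)))
      go (suc m) f f≈0 = begin
        Φ f              ≈⟨ cong Φ-lin (λ k _ → split k) ⟨
        Φ (a *ₛ b +ₛ g)  ≈⟨ linear Φ-lin a b g ⟩
        a * Φ b + Φ g    ≈⟨ +-cong (*-congˡ (agree m)) (go m g g≈0) ⟩
        a * Ψ b + Ψ g    ≈⟨ linear Ψ-lin a b g ⟨
        Ψ (a *ₛ b +ₛ g)  ≈⟨ cong Ψ-lin (λ k _ → split k) ⟩
        Ψ f              ∎
        where
        λᵐ#0 = ^-#0 λ₀#0 m
        a = f m * recip (λ₀ ^ m) λᵐ#0
        b g : Series
        b = e (m · λ₀)
        g k = f k - a * b k
        split : ∀ k → (a *ₛ b +ₛ g) k ≈ f k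
        split k = trans (+-comm _ _) (//-rightDividesˡ (a * b k) (f k))
        a*bₘ≈fₘ : a * b m ≈ f m
        a*bₘ≈fₘ = begin
          f m * recip (λ₀ ^ m) λᵐ#0 * b m        ≈⟨ *-congˡ (exp-iλ-diagonal λ₀ m) ⟩
          f m * recip (λ₀ ^ m) λᵐ#0 * λ₀ ^ m     ≈⟨ solve 3 (λ f r p → f :* r :* p := f :* (p :* r)) refl _ _ _ ⟩
          f m * (λ₀ ^ m * recip (λ₀ ^ m) λᵐ#0)   ≈⟨ *-congˡ (recip-inverse (λ₀ ^ m) λᵐ#0) ⟩
          f m * 1#                               ≈⟨ *-identityʳ (f m) ⟩
          f m                                    ∎
        g≈0 : ∀ k → m ≤ k → k < N → g k ≈ 0#
        g≈0 k m≤k k<N with ℕ.m≤n⇒m<n∨m≡n m≤k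
        ... | inj₂ ≡.refl = trans (+-congˡ (-‿cong a*bₘ≈fₘ)) (-‿inverseʳ (f m))
        ... | inj₁ m<k    = begin
          f k - a * b k  ≈⟨ +-cong (f≈0 k m<k k<N) (-‿cong (trans (*-congˡ (exp-iλ-above λ₀ m k m<k)) (zeroʳ a))) ⟩
          0# - 0#        ≈⟨ -‿inverseʳ 0# ⟩
          0#             ∎

    -- As operators in t, Θ a = (1 + λ t) d/dt + a, for which e_λ^x(t) is an eigenvector.
    Θ : Carrier → Series → Series
    Θ a f k = (suc k · 1#) * f (suc k) + (k · λ₀ + a) * f k

    Θ-exp : ∀ a x k → Θ a (e x) k ≈ (x + a) * e x k
    Θ-exp a x k = begin
      (suc k · 1#) * e x (suc k) + (k · λ₀ + a) * e x k
        ≈⟨ +-congʳ (exp-suc λ₀ x k) ⟩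
      (x - k · λ₀) * e x k + (k · λ₀ + a) * e x k
        ≈⟨ solve 4 (λ d m a f → d :* f :+ (m :+ a) :* f := (d :+ m :+ a) :* f) refl (x - k · λ₀) (k · λ₀) a (e x k) ⟩
      (x - k · λ₀ + k · λ₀ + a) * e x k
        ≈⟨ *-congʳ (+-congʳ (//-rightDividesˡ (k · λ₀) x)) ⟩
      (x + a) * e x k ∎

    -- The functional with e_λ^x(t) ↦ (x + a)_n.
    fallingFunctional : Carrier → ℕ → Series → Carrier
    fallingFunctional a zero    f = f 0
    fallingFunctional a (suc n) f = fallingFunctional a n (Θ (a - n · 1#) f)

    -- Each application of `Θ` reads one coefficient further, and the constant term is taken after
    -- `n` of them: hence the bound `suc n`.
    fallingFunctional-isFinitaryLinear : ∀ a n → IsFinitaryLinear (suc n) (fallingFunctional a n)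
    fallingFunctional-isFinitaryLinear a zero .cong f≈g = f≈g 0 (s≤s z≤n)
    fallingFunctional-isFinitaryLinear a zero .linear b f g = refl
    fallingFunctional-isFinitaryLinear a (suc n) .cong f≈g =
      cong (fallingFunctional-isFinitaryLinear a n)
        (λ k k<N → +-cong (*-congˡ (f≈g (suc k) (s≤s k<N))) (*-congˡ (f≈g k (ℕ.m<n⇒m<1+n k<N))))
    fallingFunctional-isFinitaryLinear a (suc n) .linear b f g =
      trans (cong (fallingFunctional-isFinitaryLinear a n) (λ k _ →
               solve 7 (λ s d b f′ g′ f g → s :* (b :* f′ :+ g′) :+ d :* (b :* f :+ g)
                                         := b :* (s :* f′ :+ d :* f) :+ (s :* g′ :+ d :* g)) refl
                 (suc k · 1#) (k · λ₀ + (a - n · 1#)) b (f (suc k)) (g (suc k)) (f k) (g k)))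
        (linear (fallingFunctional-isFinitaryLinear a n) b (Θ (a - n · 1#) f) (Θ (a - n · 1#) g))

    -- The operators act on the common eigenvector `e x` by the scalars `x + a - j` for j < n, and
    -- its constant term is 1.
    fallingFunctional-exp : ∀ a n x → fallingFunctional a n (e x) ≈ falling (x + a) n
    fallingFunctional-exp a zero    x = exp₀≈1 λ₀ x
    fallingFunctional-exp a (suc n) x = begin
      fallingFunctional a n (Θ (a - n · 1#) (e x))
        ≈⟨ cong lin (λ k _ → Θ-exp (a - n · 1#) x k) ⟩
      fallingFunctional a n (λ k → (x + (a - n · 1#)) * e x k)
        ≈⟨ scale lin (x + (a - n · 1#)) (e x) ⟩
      (x + (a - n · 1#)) * fallingFunctional a n (e x)
        ≈⟨ *-cong (sym (+-assoc x a _)) (fallingFunctional-exp a n x) ⟩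
      (x + a - n · 1#) * falling (x + a) n
        ≈⟨ *-comm _ _ ⟩
      falling (x + a) (suc n) ∎
      where lin = fallingFunctional-isFinitaryLinear a n

    -- The functional ψ on multiples of e^1 - 1

    private
      e-1 B : Series
      e-1 = e 1# ⊖ 1ₛ
      B = t/[e-1] λ₀ ⊛ e (1# - λ₀)

    [e-1]⊛exp-iλ : ∀ i n → (e-1 ⊛ e (i · λ₀)) n ≈ (- 1# *ₛ e (i · λ₀) +ₛ e (i · λ₀ + 1#)) n
    [e-1]⊛exp-iλ i n = begin
      (e-1 ⊛ e x) n
        ≈⟨ ⊛-congˡ n (e x) (λ k → trans (+-comm (e 1# k) (- 1ₛ k)) (+-congʳ (sym (-1*x≈-x (1ₛ k))))) ⟩
      ((- 1# *ₛ 1ₛ +ₛ e 1#) ⊛ e x) n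
        ≈⟨ ⊛-linearˡ (e x) (- 1#) 1ₛ (e 1#) n ⟩
      - 1# * (1ₛ ⊛ e x) n + (e 1# ⊛ e x) n
        ≈⟨ +-cong (*-congˡ (⊛-identityˡ (e x) n)) (trans (exp-⊛ λ₀ 1# i n) (exp-cong λ₀ (+-comm 1# x) n)) ⟩
      - 1# * e x n + e (x + 1#) n ∎
      where x = i · λ₀

    -- The denominator of the generating function cancels, leaving t e^{1-λ}.
    [e-1]⊛B : ∀ n → (e-1 ⊛ B) n ≈ shift (e (1# - λ₀)) n
    [e-1]⊛B n = begin
      (e-1 ⊛ B) n
        ≈⟨ ⊛-assoc e-1 (t/[e-1] λ₀) (e (1# - λ₀)) n ⟨
      ((e-1 ⊛ t/[e-1] λ₀) ⊛ e (1# - λ₀)) n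
        ≈⟨ ⊛-congˡ n (e (1# - λ₀)) ([e-1]⊛t/[e-1] λ₀) ⟩
      (tₛ ⊛ e (1# - λ₀)) n
        ≈⟨ tₛ-⊛ (e (1# - λ₀)) n ⟩
      shift (e (1# - λ₀)) n ∎

    private
      -- Chosen so that `1# - λ₀ + a` is 0 and `1# + a` is λ: ψ then kills e^{1-λ} and sends e^1 to
      -- (λ)_n.
      a : Carrier
      a = λ₀ - 1#

    module _ (m : ℕ) where
      private
        n = suc m
        ψ : Series → Carrier
        ψ = fallingFunctional a n
        ψ-lin = fallingFunctional-isFinitaryLinear a n

      -- Multiplying by e^1 - 1 becomes, under ψ, the forward difference of the falling factorial.
      ψ-[e-1]⊛exp-iλ : ∀ i → ψ (e-1 ⊛ e (i · λ₀)) ≈ (n · 1#) * falling (i · λ₀ + a) m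
      ψ-[e-1]⊛exp-iλ i = begin
        ψ (e-1 ⊛ e x)
          ≈⟨ cong ψ-lin (λ k _ → [e-1]⊛exp-iλ i k) ⟩
        ψ (- 1# *ₛ e x +ₛ e (x + 1#))
          ≈⟨ linear ψ-lin (- 1#) (e x) (e (x + 1#)) ⟩
        - 1# * ψ (e x) + ψ (e (x + 1#))
          ≈⟨ +-cong (trans (-1*x≈-x _) (-‿cong (fallingFunctional-exp a n x))) (fallingFunctional-exp a n (x + 1#)) ⟩
        - falling (x + a) n + falling (x + 1# + a) n
          ≈⟨ +-comm _ _ ⟩
        falling (x + 1# + a) n - falling (x + a) n
          ≈⟨ +-congʳ (falling-cong (solve 3 (λ x o a → x :+ o :+ a := x :+ a :+ o) refl x 1# a) n) ⟩
        falling (x + a + 1#) n - falling (x + a) n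
          ≈⟨ +-congʳ (falling-pascal (x + a) m) ⟩
        (n · 1#) * falling (x + a) m + falling (x + a) n - falling (x + a) n
          ≈⟨ //-rightDividesʳ _ _ ⟩
        (n · 1#) * falling (x + a) m ∎
        where x = i · λ₀

      -- Keeping the factor λ avoids a division: λt e^{1-λ} = e^1 - e^{1-λ}.
      λ*ψ-[e-1]⊛B : λ₀ * ψ (e-1 ⊛ B) ≈ falling λ₀ n
      λ*ψ-[e-1]⊛B = begin
        λ₀ * ψ (e-1 ⊛ B)
          ≈⟨ *-congˡ (cong ψ-lin (λ k _ → [e-1]⊛B k)) ⟩
        λ₀ * ψ (shift (e (1# - λ₀)))
          ≈⟨ +-identityʳ _ ⟨
        λ₀ * ψ (shift (e (1# - λ₀))) + 0#
          -- The zero is rewritten as ψ(e^{1-λ}) to complete the combination in `exp-+λ`.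
          ≈⟨ +-congˡ ψ-exp[1-λ] ⟨
        λ₀ * ψ (shift (e (1# - λ₀))) + ψ (e (1# - λ₀))
          ≈⟨ linear ψ-lin λ₀ (shift (e (1# - λ₀))) (e (1# - λ₀)) ⟨
        ψ (λ₀ *ₛ shift (e (1# - λ₀)) +ₛ e (1# - λ₀))
          ≈⟨ cong ψ-lin (λ k _ → exp-+λ λ₀ (1# - λ₀) k) ⟨
        ψ (e (1# - λ₀ + λ₀))
          ≈⟨ cong ψ-lin (λ k _ → exp-cong λ₀ (//-rightDividesˡ λ₀ 1#) k) ⟩
        ψ (e 1#)
          ≈⟨ fallingFunctional-exp a n 1# ⟩
        falling (1# + a) n
          ≈⟨ falling-cong (trans (+-comm 1# a) (//-rightDividesˡ 1# λ₀)) n ⟩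
        falling λ₀ n ∎
        where
        [1-λ]+a≈0 : 1# - λ₀ + a ≈ 0#
        [1-λ]+a≈0 = begin
          1# - λ₀ + (λ₀ - 1#)   ≈⟨ +-assoc (1# - λ₀) λ₀ (- 1#) ⟨
          1# - λ₀ + λ₀ - 1#     ≈⟨ +-congʳ (//-rightDividesˡ λ₀ 1#) ⟩
          1# - 1#               ≈⟨ -‿inverseʳ 1# ⟩
          0#                    ∎
        ψ-exp[1-λ] : ψ (e (1# - λ₀)) ≈ 0#
        ψ-exp[1-λ] = trans (fallingFunctional-exp a n (1# - λ₀)) (trans (falling-cong [1-λ]+a≈0 n) (falling-0 m))

      -- Degenerate Stirling numbers and the comparison of the two functionals

      module _ (S : ℕ → ℕ → Carrier) (isStirling : IsDegenerateStirling₁ λ₀ S) where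
        private
          T : Series
          T j = S n (suc j)

        -- Evaluate the defining expansion at 0: every term with k ≥ 1 vanishes, and so does (0)_n
        -- because n ≥ 1.
        stirling-0 : S n 0 ≈ 0#
        stirling-0 = begin
          S n 0                                      ≈⟨ *-identityʳ _ ⟨
          S n 0 * 1#                                 ≈⟨ +-identityʳ _ ⟨
          S n 0 * 1# + 0#
            ≈⟨ +-congˡ (vanishes (weightedSum-isFinitaryLinear n T) (λ j → fallingBy λ₀ 0# (suc j)) (λ j _ → fallingBy-0 λ₀ j)) ⟨
          S n 0 * 1# + weightedSum n T (λ j → fallingBy λ₀ 0# (suc j))
            ≈⟨ isStirling n 0# ⟨
          falling 0# n                               ≈⟨ falling-0 m ⟩
          0#                                         ∎

        -- Cancelling the common factor x + λ from the expansion of (x + λ)_n.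
        stirling-expansion : ∀ x → x + λ₀ # 0# → weightedSum n T (fallingBy λ₀ x) ≈ falling (x + a) m
        stirling-expansion x x+λ#0 = *-cancelˡ-# x+λ#0 (begin
          (x + λ₀) * weightedSum n T (fallingBy λ₀ x)
            ≈⟨ scale sum-lin (x + λ₀) (fallingBy λ₀ x) ⟨
          weightedSum n T (λ j → (x + λ₀) * fallingBy λ₀ x j)
            ≈⟨ cong sum-lin (λ j _ → sym (fallingBy-+μ λ₀ x j)) ⟩
          weightedSum n T (λ j → fallingBy λ₀ (x + λ₀) (suc j))
            ≈⟨ +-identityˡ _ ⟨
          0# + weightedSum n T (λ j → fallingBy λ₀ (x + λ₀) (suc j))
            ≈⟨ +-congʳ (trans (*-congʳ stirling-0) (zeroˡ 1#)) ⟨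
          S n 0 * 1# + weightedSum n T (λ j → fallingBy λ₀ (x + λ₀) (suc j))
            ≈⟨ isStirling n (x + λ₀) ⟨
          falling (x + λ₀) n
            ≈⟨ falling-cong x+a+1≈x+λ n ⟨
          falling (x + a + 1#) n
            ≈⟨ falling-+1 (x + a) m ⟩
          (x + a + 1#) * falling (x + a) m
            ≈⟨ *-congʳ x+a+1≈x+λ ⟩
          (x + λ₀) * falling (x + a) m ∎)
          where
          sum-lin = weightedSum-isFinitaryLinear n T
          x+a+1≈x+λ : x + a + 1# ≈ x + λ₀
          x+a+1≈x+λ = trans (+-assoc x a 1#) (+-congˡ (//-rightDividesˡ 1# λ₀))

        private
          -- The weights of the second functional. The factorial turns the coefficients of e^x into
          -- falling factorials, and those of `B` into Bernoulli values.
          w : Series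
          w j = (n · 1#) * (T j * ((j !) · 1#))

          pull-n : ∀ f → weightedSum n w f ≈ (n · 1#) * weightedSum n T (λ j → ((j !) · 1#) * f j)
          pull-n f = trans
            (sum-cong-≋ (λ (i : Fin n) →
              solve 4 (λ n t j f → n :* (t :* j) :* f := n :* (t :* (j :* f))) refl
                (n · 1#) (T (toℕ i)) ((toℕ i !) · 1#) (f (toℕ i))))
            (sym (*-distribˡ-sum (n · 1#) (λ (i : Fin n) → T (toℕ i) * (((toℕ i !) · 1#) * f (toℕ i)))))

        -- The sum is (i + 1)λ, a product of two invertible elements by characteristic zero; this
        -- licenses the cancellation at the test points.
        iλ+λ#0 : ∀ i → i · λ₀ + λ₀ # 0#
        iλ+λ#0 i = #-congʳ (trans (sym (·-as-* (suc i) λ₀)) (+-comm λ₀ (i · λ₀)))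
          (x#0y#0→xy#0 (charZero (suc i)) λ₀#0)

        weighted≈ψ : ∀ f → weightedSum n w f ≈ ψ (e-1 ⊛ f)
        weighted≈ψ = functionals-agree (weightedSum-isFinitaryLinear n w) (⊛-isFinitaryLinear e-1 ψ-lin)
          -- The weighted sum reads `n` coefficients and ψ reads `suc n`.
          (ℕ.n≤1+n n) (λ i → begin
            weightedSum n w (e (i · λ₀))
              ≈⟨ pull-n (e (i · λ₀)) ⟩
            (n · 1#) * weightedSum n T (λ j → ((j !) · 1#) * e (i · λ₀) j)
              ≈⟨ *-congˡ (cong (weightedSum-isFinitaryLinear n T) (λ j _ → k!*exp λ₀ (i · λ₀) j)) ⟩
            (n · 1#) * weightedSum n T (fallingBy λ₀ (i · λ₀))
              ≈⟨ *-congˡ (stirling-expansion (i · λ₀) (iλ+λ#0 i)) ⟩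
            (n · 1#) * falling (i · λ₀ + a) m
              ≈⟨ ψ-[e-1]⊛exp-iλ i ⟨
            ψ (e-1 ⊛ e (i · λ₀)) ∎)

        bernoulli-stirling-sum :
          (λ₀ ^ m /ℕ n) * fallingBy (recip λ₀ λ₀#0) 1# n
            ≈ ∑[ i < n ] (β λ₀ (toℕ i) (1# - λ₀) * S n (suc (toℕ i)))
        -- Both sides are compared after multiplication by λn, where each equals (λ)_n.
        bernoulli-stirling-sum = *-cancelˡ-# (charZero n) (*-cancelˡ-# λ₀#0 (begin
          λ₀ * ((n · 1#) * (λ₀ ^ m * r * p))
            ≈⟨ solve 5 (λ l n q r p → l :* (n :* (q :* r :* p)) := (n :* r) :* (l :* q :* p)) refl λ₀ (n · 1#) (λ₀ ^ m) r p ⟩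
          (n · 1#) * r * (λ₀ ^ n * p)
            ≈⟨ *-cong (recip-inverse (n · 1#) (charZero n)) (^*fallingBy-recip λ₀ λ₀#0 n) ⟩
          1# * falling λ₀ n
            ≈⟨ *-identityˡ _ ⟩
          falling λ₀ n
            ≈⟨ λ*ψ-[e-1]⊛B ⟨
          λ₀ * ψ (e-1 ⊛ B)
            ≈⟨ *-congˡ (weighted≈ψ B) ⟨
          λ₀ * weightedSum n w B
            ≈⟨ *-congˡ (pull-n B) ⟩
          λ₀ * ((n · 1#) * weightedSum n T (λ j → ((j !) · 1#) * B j))
            -- By definition `((j !) · 1#) * B j` is `β λ₀ j (1# - λ₀)`, so only the order of the
            -- factors changes.
            ≈⟨ *-congˡ (*-congˡ (sum-cong-≋ (λ (i : Fin n) → *-comm (T (toℕ i)) (β λ₀ (toℕ i) (1# - λ₀))))) ⟩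
          λ₀ * ((n · 1#) * ∑[ i < n ] (β λ₀ (toℕ i) (1# - λ₀) * S n (suc (toℕ i)))) ∎))
          where
          r = recip (n · 1#) (charZero n)
          p = fallingBy (recip λ₀ λ₀#0) 1# n

  identity : Identity Carrier _≈_ _#_ _*_ _-_ 0# 1# _^_ recip _/ℕ_ sum-syntax fallingBy β IsDegenerateStirling₁
  identity .Identity.holds λ₀ λ₀#0 (suc m) S isStirling = bernoulli-stirling-sum λ₀ λ₀#0 m S isStirling

-- Specialization to the real numbers

open import Defs

private
  ℝ-identity : Identity ℝ _≈_ _#_ _*_ _-_ 0# 1# _^_ recip _/ℕ_ sum-syntax fallingBy β IsDegenerateStirling₁
  ℝ-identity = DegenerateProperties.identity ℝ-heytingField ℝ-characteristicZero

theorem10 : (λ₀ : ℝ) (λ₀#0 : λ₀ # 0#) (n : ℕ) → .{{_ : NonZero n}} →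
    (S₁ : ℕ → ℕ → ℝ) → IsDegenerateStirling₁ λ₀ S₁ →
    ((λ₀ ^ (n ∸ 1)) /ℕ n) * fallingBy (recip λ₀ λ₀#0) 1# n
    ≈ ∑[ i < n ] (β λ₀ (toℕ i) (1# - λ₀) * S₁ n (suc (toℕ i)))
theorem10 = Identity.holds ℝ-identity
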